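{- Let $k\ge1$ be an integer and let $G$ be a finite graph. Assume that $G$ is $(k-1)$-connected, and that every pair $x,y$ of adjacent vertices of $G$ has at least one of the following properties: (i) $x$ and $y$ have at least $k-3$ common neighbours; (ii) $x$ and $y$ are joined by at least $\lfloor\frac32(k-2)\rfloor$ independent paths other than the edge $xy$; (iii) $x$ and $y$ lie in a common $k$-block. Then $G$ has a canonical tree-decomposition of adhesion $<k$ such that every part containing a $k$-block is a $k$-block. In particular, distinct $k$-blocks are contained in different parts.
   Context: A $k$-block of $G$ is a maximal set $X$ of at least $k$ vertices such that no two vertices $x,x'\in X$ can be separated in $G$ by fewer than $k$ vertices other than $x$ and $x'$. $G$ is $(k-1)$-connected if it has more than $k-1$ vertices and no set of fewer than $k-1$ vertices separates it. Paths between $x$ and $y$ are independent if they are pairwise disjoint apart from their endvertices $x,y$. For a tree-decomposition $(T,(V_t)_{t\in T})$ of $G$, the sets $V_t$ are its parts; it has adhesion $<k$ if $|V_t\cap V_{t'}|<k$ for every edge $tt'$ of $T$. It is canonical if it is invariant under the automorphisms of $G$: for every automorphism $\alpha$ of $G$ there is an automorphism $\varphi$ of $T$ with $\alpha(V_t)=V_{\varphi(t)}$ for all $t\in T$. -}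

module Defs where

open import Level using (0ℓ)
open import Data.Fin.Base using (Fin)
open import Data.Fin.Permutation using (Permutation′; _⟨$⟩ʳ_; _⟨$⟩ˡ_)
open import Data.Fin.Subset using (Subset; _∈_; _∉_; _⊆_; _∩_; ∣_∣)
open import Data.List.Base using (List; []; _∷_; length)
open import Data.List.Membership.Propositional using () renaming (_∈_ to _∈ˡ_)
open import Data.List.Relation.Unary.Unique.Propositional using (Unique)
open import Data.Nat.Base using (ℕ; _≤_; _<_)
open import Data.Product.Base using (Σ-syntax; ∃-syntax; _×_; proj₁)
open import Data.Sum.Base using (_⊎_)
open import Data.Vec.Base using (tabulate; lookup)
open import Function.Bundles using (_⇔_)
open import Relation.Binary.Construct.Closure.ReflexiveTransitive using (Star; ε; _◅_)
open import Relation.Binary.Core using (Rel)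
open import Relation.Binary.Definitions using (Decidable; Irreflexive; Symmetric)
open import Relation.Binary.PropositionalEquality using (_≡_; _≢_)
open import Relation.Nullary using (¬_; does)
open import Relation.Nullary.Decidable using (_×-dec_)

-- Finite simple graphs on n vertices.  Decidability of adjacency is part of
-- being a finite graph.
record Graph (n : ℕ) : Set₁ where
  field
    Adj    : Rel (Fin n) 0ℓ
    Adj?   : Decidable Adj
    sym    : Symmetric Adj
    irrefl : Irreflexive _≡_ Adj

module _ {n : ℕ} (G : Graph n) where
  open Graph G

  Walk : Fin n → Fin n → Set
  Walk = Star Adj

  walkVertices : ∀ {x y} → Walk x y → List (Fin n)
  walkVertices {x} ε       = x ∷ []
  walkVertices {x} (_ ◅ w) = x ∷ walkVertices w

  Path : Fin n → Fin n → Set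
  Path x y = Σ[ w ∈ Walk x y ] Unique (walkVertices w)

  vertices : ∀ {x y} → Path x y → List (Fin n)
  vertices p = walkVertices (proj₁ p)

  -- The vertices x and y are separated by vertices other than x and y.  For
  -- x ≡ y this never holds, because of the trivial path.
  Separates : Subset n → Fin n → Fin n → Set
  Separates S x y =
    x ∉ S × y ∉ S × (∀ (p : Path x y) → ∃[ v ] (v ∈ˡ vertices p × v ∈ S))

  Connected : ℕ → Set
  Connected l =
    l < n × (∀ S → ∣ S ∣ < l → ¬ (∃[ x ] ∃[ y ] Separates S x y))

  Inseparable : ℕ → Subset n → Set
  Inseparable k X =
    ∀ x x′ → x ∈ X → x′ ∈ X → x ≢ x′ →
    ¬ (∃[ S ] (∣ S ∣ < k × Separates S x x′))

  IsBlock : ℕ → Subset n → Set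
  IsBlock k X =
    (k ≤ ∣ X ∣ × Inseparable k X) ×
    (∀ Y → k ≤ ∣ Y ∣ → Inseparable k Y → X ⊆ Y → Y ⊆ X)

  commonNeighbours : Fin n → Fin n → Subset n
  commonNeighbours x y = tabulate λ v → does (Adj? x v ×-dec Adj? y v)

  Independent : ∀ {x y} → Path x y → Path x y → Set
  Independent {x} {y} p q =
    ∀ v → v ∈ˡ vertices p → v ∈ˡ vertices q → v ≡ x ⊎ v ≡ y

  -- Excluding the edge xy also makes the paths of the family distinct when
  -- x ≢ y: each of them has an inner vertex, which lies on no other.
  IndependentPathsOffEdge : ℕ → Fin n → Fin n → Set
  IndependentPathsOffEdge m x y =
    Σ[ p ∈ (Fin m → Path x y) ]
      (∀ i → vertices (p i) ≢ x ∷ y ∷ []) ×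
      (∀ i j → i ≢ j → Independent (p i) (p j))

  -- A cycle is a path on at least three vertices together with an edge joining
  -- its ends.
  Acyclic : Set
  Acyclic = ∀ x y (p : Path x y) → 3 ≤ length (vertices p) → ¬ Adj y x

  IsTree : Set
  IsTree = 0 < n × (∀ x y → Path x y) × Acyclic

  IsAutomorphism : Permutation′ n → Set
  IsAutomorphism α = ∀ x y → Adj x y ⇔ Adj (α ⟨$⟩ʳ x) (α ⟨$⟩ʳ y)

-- The direct image α(X): a vertex v lies in it iff α⁻¹(v) lies in X.
image : ∀ {n} → Permutation′ n → Subset n → Subset n
image α X = tabulate λ v → lookup X (α ⟨$⟩ˡ v)

record TreeDecomposition {n : ℕ} (G : Graph n) : Set₁ where
  field
    order        : ℕ
    T            : Graph order
    isTree       : IsTree T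
    part         : Fin order → Subset n
    coversVertex : ∀ v → ∃[ t ] v ∈ part t
    coversEdge   : ∀ x y → Graph.Adj G x y → ∃[ t ] (x ∈ part t × y ∈ part t)
    onPath       : ∀ t₁ t₂ t₃ (p : Path T t₁ t₃) → t₂ ∈ˡ vertices T p →
                   part t₁ ∩ part t₃ ⊆ part t₂

module _ {n : ℕ} {G : Graph n} (D : TreeDecomposition G) where
  open TreeDecomposition D

  AdhesionBelow : ℕ → Set
  AdhesionBelow k = ∀ t t′ → Graph.Adj T t t′ → ∣ part t ∩ part t′ ∣ < k

  Canonical : Set
  Canonical =
    ∀ (α : Permutation′ n) → IsAutomorphism G α →
    Σ[ φ ∈ Permutation′ order ]
      IsAutomorphism T φ × (∀ t → image α (part t) ≡ part (φ ⟨$⟩ʳ t))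

  BlockPartsAreBlocks : ℕ → Set
  BlockPartsAreBlocks k =
    ∀ t B → IsBlock G k B → B ⊆ part t → IsBlock G k (part t)

  -- Every k-block lies in some part, and parts containing distinct k-blocks
  -- differ as sets of vertices (hence also as nodes of the tree).
  BlocksInDifferentParts : ℕ → Set
  BlocksInDifferentParts k =
    (∀ B → IsBlock G k B → ∃[ t ] B ⊆ part t) ×
    (∀ B B′ → IsBlock G k B → IsBlock G k B′ → B ≢ B′ →
     ∀ t t′ → B ⊆ part t → B′ ⊆ part t′ → part t ≢ part t′)

{-# OPTIONS --safe #-}
module Submission where

{-
A separation of order < k is encoded by one of its open sides U, the separator
being the boundary ∂U.  Let vw be an edge outside a k-block X, and let U ∋ v and
W ∋ w be disjoint from X with |∂U|, |∂W| < k.  Then |∂(U ∪ W)| < k: for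
U ∩ W ≠ ∅ by submodularity of |∂| and (k − 1)-connectedness, and for U ∩ W = ∅
because otherwise |N[U] ∩ N[W]| ≤ k − 2, which each of (i), (ii), (iii) for vw
excludes.  Taking a largest such U shows that |∂C| < k for every component C of
G − X.

The separations given by the components of G − X, over all k-blocks X, are
nested.  Of each of them keep the smaller side, or both in case of a tie.  Two
members of the resulting automorphism-invariant family are comparable under
inclusion unless they neither meet nor are joined by an edge.  Together with V
they form a rooted tree, in which the part of U is N[U] without the smaller
members.  The part containing a k-block X avoids all components of G − X, and so
equals X.
-}

open import Defs
open import Data.Bool.Base using (true; false)
open import Data.Empty using (⊥-elim)
open import Data.Fin.Base using (Fin; zero; suc)
open import Data.Fin.Permutation using (Permutation′; _⟨$⟩ʳ_; _⟨$⟩ˡ_; flip; permutation; inverseˡ; inverseʳ)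
open import Data.Fin.Properties using (_≟_; any?; all?)
open import Data.Fin.Subset
open import Data.Fin.Subset.Properties
import Data.List.Base as List
open import Data.List.Base using (List; []; _∷_; length)
open import Data.List.Membership.Propositional using () renaming (_∈_ to _∈ˡ_)
open import Data.List.Membership.Propositional.Properties
  using (∈-lookup; ∈-filter⁺; ∈-filter⁻; ∈-++⁺ˡ; ∈-++⁺ʳ; ∈-map⁺; ∈-map⁻)
open import Data.List.Relation.Unary.All as All using ([]; _∷_)
open import Data.List.Relation.Unary.AllPairs using ([]; _∷_)
open import Data.List.Relation.Unary.Any using (here; there; index)
open import Data.List.Relation.Unary.Any.Properties using (lookup-index)
open import Data.List.Relation.Unary.Unique.Propositional using (Unique)
import Data.List.Relation.Unary.Unique.Propositional.Properties as Unique
open import Data.Nat.Base using (ℕ; zero; suc; _+_; _∸_; _*_; _/_; _%_; _≤_; _<_; z≤n; s≤s)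
open import Data.Nat.DivMod using (m≡m%n+[m/n]*n; m%n<n)
open import Data.Nat.Induction using (<-wellFounded)
import Data.Nat.Properties as ℕ
open import Data.Nat.Solver using (module +-*-Solver)
open import Data.Product.Base using (Σ-syntax; ∃; ∃-syntax; _×_; _,_; proj₁; proj₂)
open import Data.Sum.Base using (_⊎_; inj₁; inj₂; [_,_]′)
open import Data.Vec.Base as Vec using ([]; _∷_; tabulate; here; there)
open import Data.Vec.Properties using (lookup⇒[]=; []=⇒lookup; lookup∘tabulate; ∷-injectiveʳ)
open import Function.Base using (_∘_; id; case_of_)
open import Function.Bundles using (mk⇔; Equivalence)
open import Induction.WellFounded using (Acc; acc)
open import Level using (0ℓ)
open import Relation.Binary.Construct.Closure.ReflexiveTransitive using (ε; _◅_)
open import Relation.Binary.PropositionalEquality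
  using (_≡_; _≢_; refl; sym; trans; cong; subst; subst₂)
open import Relation.Nullary using (¬_; Dec; yes; no; does; contradiction)
open import Relation.Nullary.Decidable
  using (¬?; _×-dec_; _⊎-dec_; _→-dec_; map′; dec-true; decidable-stable)
open import Relation.Unary using (Pred; Decidable)

private
  variable
    m n : ℕ

-- Finite sets: counting, exhaustive search and extremal choice.

module _ {P : Pred (Fin n) 0ℓ} (P? : Decidable P) where

  ⟪_⟫ : Subset n
  ⟪_⟫ = tabulate (does ∘ P?)

  ∈⟪⟫⁺ : ∀ {v} → P v → v ∈ ⟪_⟫
  ∈⟪⟫⁺ {v} Pv = lookup⇒[]= v _ (trans (lookup∘tabulate _ v) (dec-true (P? v) Pv))

  ∈⟪⟫⁻ : ∀ {v} → v ∈ ⟪_⟫ → P v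
  ∈⟪⟫⁻ {v} v∈ with P? v | trans (sym (lookup∘tabulate (does ∘ P?) v)) ([]=⇒lookup v∈)
  ... | yes Pv | _ = Pv
  ... | no  _  | ()

∣p∪q∣+∣p∩q∣ : ∀ (p q : Subset n) → ∣ p ∪ q ∣ + ∣ p ∩ q ∣ ≡ ∣ p ∣ + ∣ q ∣
∣p∪q∣+∣p∩q∣ []          []          = refl
∣p∪q∣+∣p∩q∣ (true ∷ p)  (true ∷ q)  =
  cong suc (trans (ℕ.+-suc _ _) (trans (cong suc (∣p∪q∣+∣p∩q∣ p q)) (sym (ℕ.+-suc _ _))))
∣p∪q∣+∣p∩q∣ (true ∷ p)  (false ∷ q) = cong suc (∣p∪q∣+∣p∩q∣ p q)
∣p∪q∣+∣p∩q∣ (false ∷ p) (true ∷ q)  = trans (cong suc (∣p∪q∣+∣p∩q∣ p q)) (sym (ℕ.+-suc _ _))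
∣p∪q∣+∣p∩q∣ (false ∷ p) (false ∷ q) = ∣p∪q∣+∣p∩q∣ p q

-- Each side is the size of a union plus the size of an intersection, so it suffices to compare
-- unions and intersections. The submodular estimates for boundaries are instances.
∣∣-exchange : ∀ {p q r s : Subset n} → p ∪ q ⊆ r ∪ s → p ∩ q ⊆ r ∩ s →
              ∣ p ∣ + ∣ q ∣ ≤ ∣ r ∣ + ∣ s ∣
∣∣-exchange {p = p} {q} {r} {s} ∪⊆ ∩⊆ =
  subst₂ _≤_ (∣p∪q∣+∣p∩q∣ p q) (∣p∪q∣+∣p∩q∣ r s)
    (ℕ.+-mono-≤ (p⊆q⇒∣p∣≤∣q∣ ∪⊆) (p⊆q⇒∣p∣≤∣q∣ ∩⊆))

∣∣-exchange′ : ∀ {p q r s : Subset n} →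
  (∀ {v} → v ∈ p → v ∈ r ⊎ v ∈ s) → (∀ {v} → v ∈ q → v ∈ r ⊎ v ∈ s) →
  (∀ {v} → v ∈ p → v ∈ q → v ∈ r × v ∈ s) → ∣ p ∣ + ∣ q ∣ ≤ ∣ r ∣ + ∣ s ∣
∣∣-exchange′ {p = p} {q} {r} {s} f g h = ∣∣-exchange {p = p} {q} {r} {s}
  (λ v∈ → x∈p∪q⁺ ([ f , g ]′ (x∈p∪q⁻ p q v∈)))
  (λ v∈ → let v∈p , v∈q = x∈p∩q⁻ p q v∈ in x∈p∩q⁺ (h v∈p v∈q))

∣p∪q∣≤∣p∣+∣q∣ : ∀ (p q : Subset n) → ∣ p ∪ q ∣ ≤ ∣ p ∣ + ∣ q ∣
∣p∪q∣≤∣p∣+∣q∣ p q = subst (∣ p ∪ q ∣ ≤_) (∣p∪q∣+∣p∩q∣ p q) (ℕ.m≤m+n _ _)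

⊆∧∣∣≥⇒⊇ : ∀ {p q : Subset n} → p ⊆ q → ∣ q ∣ ≤ ∣ p ∣ → q ⊆ p
⊆∧∣∣≥⇒⊇ {p = p} p⊆q ∣q∣≤∣p∣ {x} x∈q with x ∈? p
... | yes x∈p = x∈p
... | no  x∉p = contradiction (p⊂q⇒∣p∣<∣q∣ (p⊆q , x , x∈q , x∉p)) (ℕ.≤⇒≯ ∣q∣≤∣p∣)

⊈⇒∃ : ∀ {p q : Subset n} → ¬ (p ⊆ q) → ∃[ x ] (x ∈ p × x ∉ q)
⊈⇒∃ {p = p} {q} p⊈q with any? (λ x → x ∈? p ×-dec ¬? (x ∈? q))
... | yes x = x
... | no ∄x = contradiction (λ {x} x∈p → decidable-stable (x ∈? q) (λ x∉q → ∄x (x , x∈p , x∉q))) p⊈q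

∣∣<⇒∃ : ∀ {p q : Subset n} → ∣ p ∣ < ∣ q ∣ → ∃[ x ] (x ∈ q × x ∉ p)
∣∣<⇒∃ ∣p∣<∣q∣ = ⊈⇒∃ (λ q⊆p → ℕ.<⇒≱ ∣p∣<∣q∣ (p⊆q⇒∣p∣≤∣q∣ q⊆p))

allSubsets? : {P : Pred (Subset n) 0ℓ} → Decidable P → Dec (∀ U → P U)
allSubsets? P? = map′ (λ ∄ U → decidable-stable (P? U) (λ ¬PU → ∄ (U , ¬PU))) (λ ∀P (U , ¬PU) → ¬PU (∀P U))
                      (¬? (anySubset? (¬? ∘ P?)))

module _ {P : Pred (Subset n) 0ℓ} (P? : Decidable P) (μ : Subset n → ℕ) where

  minimum : ∃ P → ∃[ U ] (P U × (∀ W → P W → μ U ≤ μ W))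
  minimum (U , PU) = go U PU (<-wellFounded (μ U))
    where
    go : ∀ U → P U → Acc _<_ (μ U) → ∃[ U ] (P U × (∀ W → P W → μ U ≤ μ W))
    go U PU (acc rs) with anySubset? (λ W → P? W ×-dec (μ W ℕ.<? μ U))
    ... | yes (W , PW , W<U) = go W PW (rs W<U)
    ... | no ∄W = U , PU , λ W PW → ℕ.≮⇒≥ (λ W<U → ∄W (W , PW , W<U))

∣∣-injection : ∀ (f : Fin m → Fin n) → (∀ {i j} → f i ≡ f j → i ≡ j) →
              ∀ p q → (∀ i → i ∈ p → f i ∈ q) → ∣ p ∣ ≤ ∣ q ∣
∣∣-injection f inj []          q f∈ = z≤n
∣∣-injection f inj (false ∷ p) q f∈ =
  ∣∣-injection (f ∘ suc) (λ eq → case inj eq of λ { refl → refl }) p q (λ i i∈p → f∈ (suc i) (there i∈p))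
∣∣-injection f inj (true ∷ p)  q f∈ = ℕ.≤-trans
  (s≤s (∣∣-injection (f ∘ suc) (λ eq → case inj eq of λ { refl → refl }) p (q - f zero)
         (λ i i∈p → x∈p∧x≢y⇒x∈p-y (f∈ (suc i) (there i∈p)) (λ eq → case inj eq of λ ()))))
  (x∈p⇒∣p-x∣<∣p∣ (f∈ zero here))

-- Walks, boundaries and inseparable sets.

module _ (G : Graph n) where
  private
    variable
      x y : Fin n

  start∈ : ∀ (p : Walk G x y) → x ∈ˡ walkVertices G p
  start∈ ε       = here refl
  start∈ (_ ◅ _) = here refl

  end∈ : ∀ (p : Walk G x y) → y ∈ˡ walkVertices G p
  end∈ ε       = here refl
  end∈ (_ ◅ p) = there (end∈ p)

  closed-path : ∀ (p : Path G x x) → vertices G p ≡ x ∷ []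
  closed-path (ε , _)            = refl
  closed-path (_ ◅ p , x∉p ∷ _) = contradiction refl (All.lookup x∉p (end∈ p))

module Boundary {n : ℕ} (G : Graph n) where
  open Graph G using (Adj; Adj?) renaming (sym to Adj-sym)

  adjacentFrom? : ∀ U → Decidable (λ v → v ∉ U × ∃[ u ] (u ∈ U × Adj u v))
  adjacentFrom? U v = ¬? (v ∈? U) ×-dec any? (λ u → u ∈? U ×-dec Adj? u v)

  private
    variable
      U W X : Subset n
      u v w x y : Fin n

  abstract
    ∂ : Subset n → Subset n
    ∂ U = ⟪ adjacentFrom? U ⟫

    ∂⁺ : v ∉ U → u ∈ U → Adj u v → v ∈ ∂ U
    ∂⁺ v∉U u∈U uv = ∈⟪⟫⁺ (adjacentFrom? _) (v∉U , _ , u∈U , uv)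

    ∂⁻ : v ∈ ∂ U → v ∉ U × ∃[ u ] (u ∈ U × Adj u v)
    ∂⁻ = ∈⟪⟫⁻ (adjacentFrom? _)

  N[_] : Subset n → Subset n
  N[ U ] = U ∪ ∂ U

  -- The other open side of the separation with open side U.
  opp : Subset n → Subset n
  opp U = ∁ N[ U ]

  ∂⇒∉ : v ∈ ∂ U → v ∉ U
  ∂⇒∉ v∈∂ = proj₁ (∂⁻ v∈∂)

  ⊆N : U ⊆ N[ U ]
  ⊆N = p⊆p∪q _

  ∂⊆N : ∂ U ⊆ N[ U ]
  ∂⊆N = q⊆p∪q _ _

  N⁻ : v ∈ N[ U ] → v ∈ U ⊎ v ∈ ∂ U
  N⁻ = x∈p∪q⁻ _ _

  N∖⇒∂ : v ∈ N[ U ] → v ∉ U → v ∈ ∂ U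
  N∖⇒∂ v∈N v∉U = [ (λ v∈U → contradiction v∈U v∉U) , id ]′ (N⁻ v∈N)

  adj⇒N : u ∈ U → Adj u v → v ∈ N[ U ]
  adj⇒N {U = U} {v} u∈U uv with v ∈? U
  ... | yes v∈U = ⊆N v∈U
  ... | no  v∉U = ∂⊆N (∂⁺ v∉U u∈U uv)

  N-mono : U ⊆ W → N[ U ] ⊆ N[ W ]
  N-mono {U} {W} U⊆W v∈N with N⁻ v∈N
  ... | inj₁ v∈U = ⊆N (U⊆W v∈U)
  ... | inj₂ v∈∂ = let _ , u , u∈U , uv = ∂⁻ v∈∂ in adj⇒N (U⊆W u∈U) uv

  opp⁺ : v ∉ N[ U ] → v ∈ opp U
  opp⁺ = x∉p⇒x∈∁p

  opp⁻ : v ∈ opp U → v ∉ N[ U ]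
  opp⁻ = x∈∁p⇒x∉p

  opp-anti : U ⊆ W → opp W ⊆ opp U
  opp-anti U⊆W v∈ = opp⁺ (λ v∈N → opp⁻ v∈ (N-mono U⊆W v∈N))

  ∂opp⊆∂ : ∂ (opp U) ⊆ ∂ U
  ∂opp⊆∂ {U} {v} v∈ with ∂⁻ {U = opp U} v∈
  ... | v∉opp , u , u∈opp , uv with N⁻ (x∉∁p⇒x∈p v∉opp)
  ...   | inj₁ v∈U = contradiction (adj⇒N v∈U (Adj-sym uv)) (opp⁻ u∈opp)
  ...   | inj₂ v∈∂ = v∈∂

  ⊆opp-swap : W ⊆ opp U → U ⊆ opp W
  ⊆opp-swap {W} {U} W⊆ {v} v∈U = opp⁺ λ v∈N → case N⁻ v∈N of λ where
    (inj₁ v∈W) → opp⁻ (W⊆ v∈W) (⊆N v∈U)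
    (inj₂ v∈∂) → let _ , w , w∈W , wv = ∂⁻ {U = W} v∈∂ in opp⁻ (W⊆ w∈W) (adj⇒N v∈U (Adj-sym wv))

  crossing : ∀ (p : Walk G x y) U → x ∈ U → y ∉ U →
    ∃[ a ] ∃[ b ] (a ∈ U × b ∉ U × Adj a b × a ∈ˡ walkVertices G p × b ∈ˡ walkVertices G p)
  crossing ε U x∈U y∉U = contradiction x∈U y∉U
  crossing {x} (_◅_ {j = z} xz p) U x∈U y∉U with z ∈? U
  ... | no  z∉U = x , z , x∈U , z∉U , xz , here refl , there (start∈ G p)
  ... | yes z∈U = let a , b , a∈ , b∉ , ab , a∈p , b∈p = crossing p U z∈U y∉U
                  in a , b , a∈ , b∉ , ab , there a∈p , there b∈p

  -- Starting from `y` alone, boundary vertices outside `S` are added until none is left. Each new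
  -- vertex is put in front of a path found earlier; as it lies outside the set built so far, the
  -- walk remains a path.
  reach : ∀ S y → y ∉ S → ∃[ U ] (y ∈ U × (∀ {v} → v ∈ U → v ∉ S) × ∂ U ⊆ S ×
          (∀ {u} → u ∈ U → Σ[ p ∈ Path G u y ] (∀ v → v ∈ˡ vertices G p → v ∈ U)))
  reach S y y∉S = go ⁅ y ⁆ (x∈⁅x⁆ y)
      (λ v∈ → case x∈⁅y⁆⇒x≡y y v∈ of λ { refl → y∉S })
      (λ u∈ → case x∈⁅y⁆⇒x≡y y u∈ of λ { refl → (ε , [] ∷ []) , λ { _ (here refl) → x∈⁅x⁆ y } })
      (<-wellFounded _)
    where
    Linked : Subset n → Set
    Linked U = ∀ {u} → u ∈ U → Σ[ p ∈ Path G u y ] (∀ v → v ∈ˡ vertices G p → v ∈ U)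

    go : ∀ U → y ∈ U → (∀ {v} → v ∈ U → v ∉ S) → Linked U → Acc _<_ ∣ ∁ U ∣ →
         ∃[ U ] (y ∈ U × (∀ {v} → v ∈ U → v ∉ S) × ∂ U ⊆ S × Linked U)
    go U y∈U U∩S linked (acc rs) with any? (λ v → v ∈? ∂ U ×-dec ¬? (v ∈? S))
    ... | no ∄v = U , y∈U , U∩S ,
      (λ {v} v∈∂ → decidable-stable (v ∈? S) (λ v∉S → ∄v (v , v∈∂ , v∉S))) , linked
    ... | yes (v , v∈∂ , v∉S) with ∂⁻ {U = U} v∈∂
    ...   | v∉U , u , u∈U , uv = go U′ (old y∈U)
              (λ w∈ → case x∈p∪q⁻ U ⁅ v ⁆ w∈ of λ where
                (inj₁ w∈U) → U∩S w∈U
                (inj₂ w∈v) → case x∈⁅y⁆⇒x≡y v w∈v of λ { refl → v∉S })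
              (λ w∈ → case x∈p∪q⁻ U ⁅ v ⁆ w∈ of λ where
                (inj₁ w∈U) → let p , p⊆U = linked w∈U in p , λ z z∈p → old (p⊆U z z∈p)
                (inj₂ w∈v) → case x∈⁅y⁆⇒x≡y v w∈v of λ { refl →
                  let (p , p!) , p⊆U = linked u∈U in
                  (Adj-sym uv ◅ p ,
                   All.tabulate (λ z∈p v≡z → v∉U (subst (_∈ U) (sym v≡z) (p⊆U _ z∈p))) ∷ p!) ,
                  λ { _ (here refl) → new ; z (there z∈p) → old (p⊆U z z∈p) } })
              (rs (p⊂q⇒∣p∣<∣q∣ (p⊂q⇒∁p⊃∁q (old , v , new , v∉U))))
      where
      U′ = U ∪ ⁅ v ⁆
      old : U ⊆ U′
      old = p⊆p∪q ⁅ v ⁆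
      new : v ∈ U′
      new = q⊆p∪q U ⁅ v ⁆ (x∈⁅x⁆ v)

  boundary-separates : x ∈ U → y ∈ opp U → Separates G (∂ U) x y
  boundary-separates {U = U} x∈U y∈opp =
    (λ x∈∂ → ∂⇒∉ x∈∂ x∈U) ,
    (λ y∈∂ → opp⁻ y∈opp (∂⊆N y∈∂)) ,
    λ (p , _) → let a , b , a∈ , b∉ , ab , _ , b∈p = crossing p U x∈U (λ y∈U → opp⁻ y∈opp (⊆N y∈U))
                in b , b∈p , ∂⁺ b∉ a∈ ab

  -- The side is the set of vertices linked to `y` outside `S`. It misses `x`, since a path from `x`
  -- inside it would avoid `S`.
  separates⇒boundary : ∀ S → Separates G S x y → ∃[ U ] (y ∈ U × x ∈ opp U × ∂ U ⊆ S)
  separates⇒boundary {x} {y} S (x∉S , y∉S , hit) =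
    let U , y∈U , U∩S , ∂U⊆S , linked = reach S y y∉S in
    U , y∈U ,
    opp⁺ (λ x∈N → case N⁻ x∈N of λ where
      (inj₁ x∈U) → let p , p⊆U = linked x∈U ; v , v∈p , v∈S = hit p in U∩S (p⊆U v v∈p) v∈S
      (inj₂ x∈∂) → x∉S (∂U⊆S x∈∂)) ,
    ∂U⊆S

  -- Inseparability in terms of sides instead of paths: no boundary of fewer than `k` vertices
  -- leaves vertices of `X` both in `U` and in `opp U`. This form is decided by searching all
  -- subsets and is easily transported along automorphisms.
  Unsplit : ℕ → Subset n → Set
  Unsplit k X = ∀ U → ∣ ∂ U ∣ < k → Nonempty (X ∩ U) → X ⊆ N[ U ]

  unsplit? : ∀ k → Decidable (Unsplit k)
  unsplit? k X = allSubsets? (λ U → (∣ ∂ U ∣ ℕ.<? k) →-dec (nonempty? (X ∩ U) →-dec (X ⊆? N[ U ])))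

  inseparable⇒unsplit : ∀ {k} → Inseparable G k X → Unsplit k X
  inseparable⇒unsplit {X} insep U ∂U<k (x , x∈) {y} y∈X with y ∈? N[ U ]
  ... | yes y∈N = y∈N
  ... | no  y∉N = let x∈X , x∈U = x∈p∩q⁻ X U x∈ in
    contradiction (∂ U , ∂U<k , boundary-separates x∈U (opp⁺ y∉N))
                  (insep x y x∈X y∈X (λ x≡y → y∉N (⊆N (subst (_∈ U) x≡y x∈U))))

  unsplit⇒inseparable : ∀ {k} → Unsplit k X → Inseparable G k X
  unsplit⇒inseparable uns x y x∈X y∈X x≢y (S , S<k , sep) =
    let U , y∈U , x∈opp , ∂U⊆S = separates⇒boundary S sep in
    opp⁻ x∈opp (uns U (ℕ.≤-<-trans (p⊆q⇒∣p∣≤∣q∣ ∂U⊆S) S<k) (y , x∈p∩q⁺ (y∈X , y∈U)) x∈X)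

  Block : ℕ → Subset n → Set
  Block k X = (k ≤ ∣ X ∣ × Unsplit k X) ×
              (∀ Y → k ≤ ∣ Y ∣ → Unsplit k Y → X ⊆ Y → Y ⊆ X)

  block? : ∀ k → Decidable (Block k)
  block? k X = ((k ℕ.≤? ∣ X ∣) ×-dec unsplit? k X) ×-dec
    allSubsets? (λ Y → (k ℕ.≤? ∣ Y ∣) →-dec (unsplit? k Y →-dec ((X ⊆? Y) →-dec (Y ⊆? X))))

  isBlock⇒block : ∀ {k} → IsBlock G k X → Block k X
  isBlock⇒block ((size , insep) , max) =
    (size , inseparable⇒unsplit insep) , λ Y s u → max Y s (unsplit⇒inseparable u)

-- Linkage between disjoint sides

Disjoint : Subset n → Subset n → Set
Disjoint U X = ∀ x → x ∈ U → x ∉ X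

disjoint? : ∀ (U X : Subset n) → Dec (Disjoint U X)
disjoint? U X = all? (λ x → x ∈? U →-dec ¬? (x ∈? X))

∣p∩q∣+∣p∩∁q∣≤∣p∣ : ∀ (p q : Subset n) → ∣ p ∩ q ∣ + ∣ p ∩ ∁ q ∣ ≤ ∣ p ∣
∣p∩q∣+∣p∩∁q∣≤∣p∣ {n} p q = subst (∣ p ∩ q ∣ + ∣ p ∩ ∁ q ∣ ≤_)
  (trans (cong (∣ p ∣ +_) (∣⊥∣≡0 n)) (ℕ.+-identityʳ _))
  (∣∣-exchange′ {p = p ∩ q} {p ∩ ∁ q} {p} {⊥} (inj₁ ∘ p∩q⊆p p q) (inj₁ ∘ p∩q⊆p p (∁ q))
    (λ v∈ v∈′ → contradiction (p∩q⊆q p q v∈) (x∈∁p⇒x∉p (p∩q⊆q p (∁ q) v∈′))))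

-- With `j` = k - 1 the number in (ii) is m = ⌊3(j - 1)/2⌋. Rounding down loses at most 1 in 2m,
-- hence 2m ≥ 3j - 4.
3j≤2m+4 : ∀ j → 3 * j ≤ 2 * ((3 * (j ∸ 1)) / 2) + 4
3j≤2m+4 j = begin
  3 * j                    ≤⟨ ℕ.*-monoʳ-≤ 3 (ℕ.m≤n+m∸n j 1) ⟩
  3 * (1 + (j ∸ 1))        ≡⟨ ℕ.*-distribˡ-+ 3 1 (j ∸ 1) ⟩
  3 + x                    ≡⟨ cong (3 +_) (m≡m%n+[m/n]*n x 2) ⟩
  3 + (x % 2 + x / 2 * 2)  ≤⟨ ℕ.+-monoʳ-≤ 3 (ℕ.+-monoˡ-≤ (x / 2 * 2) (ℕ.≤-pred (m%n<n x 2))) ⟩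
  4 + x / 2 * 2            ≡⟨ ℕ.+-comm 4 _ ⟩
  x / 2 * 2 + 4            ≡⟨ cong (_+ 4) (ℕ.*-comm (x / 2) 2) ⟩
  2 * (x / 2) + 4          ∎
  where
  open ℕ.≤-Reasoning
  x = 3 * (j ∸ 1)

-- s counts N[U] ∩ N[W], and z the same set without the ends v, w of the edge;
-- a, d count ∂U inside and outside N[W], and b, e count ∂W inside and outside N[U].
linkage-arithmetic : ∀ {j m z s a b d e} → 3 * j ≤ 2 * m + 4 →
  2 + z ≤ s → m ≤ z + d → m ≤ z + e → a + d ≤ j → b + e ≤ j → s ≤ a + b → j ≤ s
linkage-arithmetic {j} {m} {z} {s} {a} {b} {d} {e} 3j z≤s m≤zd m≤ze ad be s≤ =
  ℕ.+-cancelʳ-≤ (2 * j) j s (begin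
    3 * j                             ≤⟨ 3j ⟩
    2 * m + 4                         ≡⟨ solve 1 (λ m → con 2 :* m :+ con 4 := (m :+ m) :+ con 4) refl m ⟩
    (m + m) + 4                       ≤⟨ ℕ.+-monoˡ-≤ 4 (ℕ.+-mono-≤ m≤zd m≤ze) ⟩
    ((z + d) + (z + e)) + 4           ≡⟨ solve 3 (λ z d e → ((z :+ d) :+ (z :+ e)) :+ con 4 :=
                                           ((con 2 :+ z) :+ (con 2 :+ z)) :+ (d :+ e)) refl z d e ⟩
    -- One copy of 2 + z is bounded by s and the other by a + b, so that a + d and b + e can be
    -- recombined into the two boundaries.
    ((2 + z) + (2 + z)) + (d + e)     ≤⟨ ℕ.+-monoˡ-≤ (d + e) (ℕ.+-mono-≤ z≤s (ℕ.≤-trans z≤s s≤)) ⟩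
    (s + (a + b)) + (d + e)           ≡⟨ solve 5 (λ s a b d e → (s :+ (a :+ b)) :+ (d :+ e) :=
                                           s :+ ((a :+ d) :+ (b :+ e))) refl s a b d e ⟩
    s + ((a + d) + (b + e))           ≤⟨ ℕ.+-monoʳ-≤ s (ℕ.+-mono-≤ ad be) ⟩
    s + (j + j)                       ≡⟨ solve 2 (λ s j → s :+ (j :+ j) := s :+ con 2 :* j) refl s j ⟩
    s + 2 * j                         ∎)
  where
  open ℕ.≤-Reasoning
  open +-*-Solver

module _ (G : Graph n) where
  private
    variable
      x y : Fin n

  -- Each path has an inner vertex in `S`, and independence makes the choice of these vertices
  -- injective.
  independent-≤ : IndependentPathsOffEdge G m x y → ∀ S →
    (∀ (p : Path G x y) → vertices G p ≢ x ∷ y ∷ [] →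
       ∃[ z ] (z ∈ˡ vertices G p × z ≢ x × z ≢ y × z ∈ S)) →
    m ≤ ∣ S ∣
  independent-≤ (p , off , indep) S mark =
    subst (_≤ ∣ S ∣) (∣⊤∣≡n _)
      (∣∣-injection (proj₁ ∘ marker) inj ⊤ S (λ i _ → let _ , _ , _ , _ , z∈S = marker i in z∈S))
    where
    marker = λ i → mark (p i) (off i)
    inj : ∀ {i j} → proj₁ (marker i) ≡ proj₁ (marker j) → i ≡ j
    inj {i} {j} eq with i ≟ j
    ... | yes i≡j = i≡j
    ... | no  i≢j =
      let z , z∈pᵢ , z≢x , z≢y , _ = marker i ; _ , z∈pⱼ , _ = marker j in
      [ (λ z≡x → contradiction z≡x z≢x) , (λ z≡y → contradiction z≡y z≢y) ]′
        (indep i j i≢j z z∈pᵢ (subst (_∈ˡ vertices G (p j)) (sym eq) z∈pⱼ))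

module Linkage (G : Graph n) {U W : Subset n} {v w : Fin n} (U∩W=∅ : Disjoint U W)
               (v∈U : v ∈ U) (w∈W : w ∈ W) (vw : Graph.Adj G v w) where
  open Graph G using (Adj; Adj?; irrefl) renaming (sym to Adj-sym)
  open Boundary G

  I Z : Subset n
  I = N[ U ] ∩ N[ W ]
  Z = I - v - w

  private
    v≢w : v ≢ w
    v≢w v≡w = irrefl v≡w vw

    w∉U : w ∉ U
    w∉U w∈U = U∩W=∅ w w∈U w∈W

    v∉W : v ∉ W
    v∉W = U∩W=∅ v v∈U

  Z⁺ : ∀ {z} → z ∈ N[ U ] → z ∈ N[ W ] → z ≢ v → z ≢ w → z ∈ Z
  Z⁺ z∈NU z∈NW z≢v z≢w = x∈p∧x≢y⇒x∈p-y (x∈p∧x≢y⇒x∈p-y (x∈p∩q⁺ (z∈NU , z∈NW)) z≢v) z≢w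

  2+∣Z∣≤∣I∣ : 2 + ∣ Z ∣ ≤ ∣ I ∣
  2+∣Z∣≤∣I∣ = ℕ.≤-trans
    (s≤s (x∈p⇒∣p-x∣<∣p∣ (x∈p∧x≢y⇒x∈p-y (x∈p∩q⁺ (adj⇒N v∈U vw , ⊆N w∈W)) (v≢w ∘ sym))))
    (x∈p⇒∣p-x∣<∣p∣ (x∈p∩q⁺ (⊆N v∈U , adj⇒N w∈W (Adj-sym vw))))

  commonNeighbours⊆Z : commonNeighbours G v w ⊆ Z
  commonNeighbours⊆Z {z} z∈ =
    let vz , wz = ∈⟪⟫⁻ (λ u → Adj? v u ×-dec Adj? w u) z∈ in
    Z⁺ (adj⇒N v∈U vz) (adj⇒N w∈W wz) (λ z≡v → irrefl (sym z≡v) vz) (λ z≡w → irrefl (sym z≡w) wz)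

  ∂-mark : ∀ {z} → z ∈ ∂ U → z ≢ w → z ∈ Z ∪ ∂ U ∩ opp W
  ∂-mark {z} z∈∂ z≢w with z ∈? N[ W ]
  ... | yes z∈NW = p⊆p∪q _ (Z⁺ (∂⊆N z∈∂) z∈NW (λ { refl → ∂⇒∉ z∈∂ v∈U }) z≢w)
  ... | no  z∉NW = q⊆p∪q _ _ (x∈p∩q⁺ (z∈∂ , opp⁺ z∉NW))

  -- mark-∂U and mark-∂W bound the number of independent paths by
  -- ∣Z∣ + ∣∂U ∖ N[W]∣ and by ∣Z∣ + ∣∂W ∖ N[U]∣; averaging the two bounds is what
  -- produces the factor 3/2 in (ii).
  mark-∂U : ∀ (p : Path G v w) → vertices G p ≢ v ∷ w ∷ [] →
            ∃[ z ] (z ∈ˡ vertices G p × z ≢ v × z ≢ w × z ∈ Z ∪ ∂ U ∩ opp W)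
  mark-∂U (ε , _) off = contradiction refl v≢w
  mark-∂U (_◅_ {j = y} vy p , v∉p ∷ p!) off with y ∈? U
  -- If `y` were `w`, the remaining path would be closed, hence trivial, and the whole path would be
  -- the excluded edge.
  ... | no y∉U = y , there (start∈ G p) , y≢v , y≢w , ∂-mark (∂⁺ y∉U v∈U vy) y≢w
    where
    y≢v : y ≢ v
    y≢v y≡v = All.lookup v∉p (start∈ G p) (sym y≡v)
    y≢w : y ≢ w
    y≢w refl = off (cong (v ∷_) (closed-path G (p , p!)))
  ... | yes y∈U with crossing p U y∈U w∉U
  ...   | a , b , a∈U , b∉U , ab , a∈p , b∈p with b ≟ w
  ...     | no b≢w = b , there b∈p , b≢v , b≢w , ∂-mark (∂⁺ b∉U a∈U ab) b≢w
    where
    b≢v : b ≢ v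
    b≢v refl = b∉U v∈U
  -- The path leaves `U` directly into `w`. The vertex before `w` then lies in `U` and is a
  -- neighbour of `w`, so it belongs to both closed neighbourhoods.
  ...     | yes refl = a , there a∈p , a≢v , a≢w ,
                       p⊆p∪q _ (Z⁺ (⊆N a∈U) (adj⇒N w∈W (Adj-sym ab)) a≢v a≢w)
    where
    a≢v : a ≢ v
    a≢v a≡v = All.lookup v∉p a∈p (sym a≡v)
    a≢w : a ≢ w
    a≢w refl = w∉U a∈U

  mark-∂W : ∀ (p : Path G v w) → vertices G p ≢ v ∷ w ∷ [] →
            ∃[ z ] (z ∈ˡ vertices G p × z ≢ v × z ≢ w × z ∈ Z ∪ ∂ W ∩ opp U)
  mark-∂W (ε , _) off = contradiction refl v≢w
  mark-∂W (_◅_ {j = y} vy p , v∉p ∷ p!) off with y ∈? W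
  ... | yes y∈W = y , there (start∈ G p) , y≢v , y≢w , p⊆p∪q _ (Z⁺ (adj⇒N v∈U vy) (⊆N y∈W) y≢v y≢w)
    where
    y≢v : y ≢ v
    y≢v y≡v = All.lookup v∉p (start∈ G p) (sym y≡v)
    y≢w : y ≢ w
    y≢w refl = off (cong (v ∷_) (closed-path G (p , p!)))
  -- Here the marker is a vertex from which the path enters `W`; it lies in `∂ W` and is not `v`,
  -- which the path does not revisit.
  ... | no y∉W with crossing p (∁ W) (x∉p⇒x∈∁p y∉W) (x∈p⇒x∉∁p w∈W)
  ...   | a , b , a∈∁W , b∉∁W , ab , a∈p , _ = a , there a∈p , a≢v , a≢w , inS
    where
    a∈∂W : a ∈ ∂ W
    a∈∂W = ∂⁺ (x∈∁p⇒x∉p a∈∁W) (x∉∁p⇒x∈p b∉∁W) (Adj-sym ab)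
    a≢v : a ≢ v
    a≢v a≡v = All.lookup v∉p a∈p (sym a≡v)
    a≢w : a ≢ w
    a≢w refl = x∈∁p⇒x∉p a∈∁W w∈W
    inS : a ∈ Z ∪ ∂ W ∩ opp U
    inS with a ∈? N[ U ]
    ... | yes a∈NU = p⊆p∪q _ (Z⁺ a∈NU (∂⊆N a∈∂W) a≢v a≢w)
    ... | no  a∉NU = q⊆p∪q _ _ (x∈p∩q⁺ (a∈∂W , opp⁺ a∉NU))

  -- The conditions on edges enter here. In (i) the common neighbours lie in `Z`, and `v`, `w` add
  -- two more vertices. In (ii) the two markings bound the number of paths. In (iii) the block meets
  -- both `U` and `W`, so unsplittability puts all of it into both closed neighbourhoods.
  ∣I∣-large : ∀ {j} → ∣ ∂ U ∣ ≤ j → ∣ ∂ W ∣ ≤ j →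
    (j ∸ 2 ≤ ∣ commonNeighbours G v w ∣)
    ⊎ IndependentPathsOffEdge G ((3 * (j ∸ 1)) / 2) v w
    ⊎ (∃[ B ] (IsBlock G (suc j) B × v ∈ B × w ∈ B)) →
    j ≤ ∣ I ∣
  ∣I∣-large {j} ∂U≤j ∂W≤j (inj₁ common) = begin
    j             ≤⟨ ℕ.m≤n+m∸n j 2 ⟩
    2 + (j ∸ 2)   ≤⟨ ℕ.+-monoʳ-≤ 2 (ℕ.≤-trans common (p⊆q⇒∣p∣≤∣q∣ commonNeighbours⊆Z)) ⟩
    2 + ∣ Z ∣     ≤⟨ 2+∣Z∣≤∣I∣ ⟩
    ∣ I ∣         ∎
    where open ℕ.≤-Reasoning
  ∣I∣-large {j} ∂U≤j ∂W≤j (inj₂ (inj₁ paths)) =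
    linkage-arithmetic {j} {z = ∣ Z ∣} {a = ∣ ∂ U ∩ N[ W ] ∣} {∣ ∂ W ∩ N[ U ] ∣} (3j≤2m+4 j) 2+∣Z∣≤∣I∣
      (ℕ.≤-trans (independent-≤ G paths _ mark-∂U) (∣p∪q∣≤∣p∣+∣q∣ Z (∂ U ∩ opp W)))
      (ℕ.≤-trans (independent-≤ G paths _ mark-∂W) (∣p∪q∣≤∣p∣+∣q∣ Z (∂ W ∩ opp U)))
      (ℕ.≤-trans (∣p∩q∣+∣p∩∁q∣≤∣p∣ (∂ U) N[ W ]) ∂U≤j)
      (ℕ.≤-trans (∣p∩q∣+∣p∩∁q∣≤∣p∣ (∂ W) N[ U ]) ∂W≤j)
      (ℕ.≤-trans (p⊆q⇒∣p∣≤∣q∣ I⊆) (∣p∪q∣≤∣p∣+∣q∣ (∂ U ∩ N[ W ]) (∂ W ∩ N[ U ])))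
    where
    I⊆ : I ⊆ ∂ U ∩ N[ W ] ∪ ∂ W ∩ N[ U ]
    I⊆ z∈I with x∈p∩q⁻ N[ U ] N[ W ] z∈I
    ... | z∈NU , z∈NW with N⁻ z∈NU
    ...   | inj₁ z∈U = q⊆p∪q _ _ (x∈p∩q⁺ (N∖⇒∂ z∈NW (U∩W=∅ _ z∈U) , z∈NU))
    ...   | inj₂ z∈∂ = p⊆p∪q _ (x∈p∩q⁺ (z∈∂ , z∈NW))
  ∣I∣-large {j} ∂U≤j ∂W≤j (inj₂ (inj₂ (B , isBlock , v∈B , w∈B))) =
    let (size , uns) , _ = isBlock⇒block isBlock in
    ℕ.≤-trans (ℕ.n≤1+n j) (ℕ.≤-trans size (p⊆q⇒∣p∣≤∣q∣ λ z∈B → x∈p∩q⁺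
      ( uns U (s≤s ∂U≤j) (v , x∈p∩q⁺ (v∈B , v∈U)) z∈B
      , uns W (s≤s ∂W≤j) (w , x∈p∩q⁺ (w∈B , w∈W)) z∈B)))

-- Components of the complement of a k-block

-- Hypotheses (i), (ii), (iii) for k = suc j.
EdgeCondition : ℕ → Graph n → Set
EdgeCondition j G = ∀ x y → Graph.Adj G x y →
  (j ∸ 2 ≤ ∣ commonNeighbours G x y ∣)
  ⊎ IndependentPathsOffEdge G ((3 * (j ∸ 1)) / 2) x y
  ⊎ (∃[ B ] (IsBlock G (suc j) B × x ∈ B × y ∈ B))

module Components (G : Graph n) where
  open Graph G using (Adj; Adj?) renaming (sym to Adj-sym)
  open Boundary G

  private
    variable
      U W X C D : Subset n
      v w : Fin n

  -- C is the vertex set of a component of G − X; connectedness is expressed by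
  -- minimality, so that it never mentions paths.
  Component : Subset n → Subset n → Set
  Component X C = Nonempty C × (Disjoint C X × ∂ C ⊆ X) ×
                  (∀ W → W ⊆ C → Nonempty W → ∂ W ⊆ X → C ⊆ W)

  component? : ∀ X → Decidable (Component X)
  component? X C = nonempty? C ×-dec (disjoint? C X ×-dec (∂ C ⊆? X)) ×-dec
    allSubsets? (λ W → (W ⊆? C) →-dec (nonempty? W →-dec ((∂ W ⊆? X) →-dec (C ⊆? W))))

  -- A boundary vertex of `D ∩ C` inside `D` would lie in `∂ C`, which `D` avoids. Hence this
  -- boundary lies in `X`, and minimality of `D` applies to `D ∩ C`.
  component-connected : Component X D → Disjoint D (∂ C) → v ∈ D → v ∈ C → D ⊆ C
  component-connected {X} {D} {C} (_ , (_ , ∂D⊆X) , conn) D∩∂C=∅ v∈D v∈C =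
    ⊆-trans (conn (D ∩ C) (p∩q⊆p D C) (_ , x∈p∩q⁺ (v∈D , v∈C)) ∂⊆X) (p∩q⊆q D C)
    where
    ∂⊆X : ∂ (D ∩ C) ⊆ X
    ∂⊆X {z} z∈∂ with ∂⁻ {U = D ∩ C} z∈∂
    ... | z∉ , u , u∈ , uz with x∈p∩q⁻ D C u∈ | z ∈? D
    ...   | u∈D , u∈C | no  z∉D = ∂D⊆X (∂⁺ z∉D u∈D uz)
    ...   | u∈D , u∈C | yes z∈D =
      contradiction (∂⁺ (λ z∈C → z∉ (x∈p∩q⁺ (z∈D , z∈C))) u∈C uz) (D∩∂C=∅ z z∈D)

  -- `C` is a smallest set around `v` that avoids `X` and has its boundary in `X`. A nonempty subset
  -- `W` of it with boundary in `X` must contain `v`, since otherwise `C ∩ ∁ W` would be a smaller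
  -- such set.
  component-of : ∀ X v → v ∉ X → ∃[ C ] (v ∈ C × Component X C)
  component-of X v v∉X =
    let C , (v∈C , C∩X=∅ , ∂C⊆X) , min = minimum P? ∣_∣ (∁ X , x∉p⇒x∈∁p v∉X , (λ x → x∈∁p⇒x∉p) , ∂∁⊆) in
    C , v∈C , (v , v∈C) , (C∩X=∅ , ∂C⊆X) , connected C v∈C C∩X=∅ ∂C⊆X min
    where
    P : Subset n → Set
    P C = v ∈ C × Disjoint C X × ∂ C ⊆ X

    P? : Decidable P
    P? C = v ∈? C ×-dec (disjoint? C X ×-dec (∂ C ⊆? X))

    ∂∁⊆ : ∂ (∁ X) ⊆ X
    ∂∁⊆ z∈∂ = x∉∁p⇒x∈p (∂⇒∉ z∈∂)

    connected : ∀ C → v ∈ C → Disjoint C X → ∂ C ⊆ X → (∀ W → P W → ∣ C ∣ ≤ ∣ W ∣) →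
                ∀ W → W ⊆ C → Nonempty W → ∂ W ⊆ X → C ⊆ W
    connected C v∈C C∩X=∅ ∂C⊆X min W W⊆C (w , w∈W) ∂W⊆X with v ∈? W
    ... | yes v∈W = ⊆∧∣∣≥⇒⊇ W⊆C (min W (v∈W , (λ x x∈W → C∩X=∅ x (W⊆C x∈W)) , ∂W⊆X))
    ... | no  v∉W = contradiction w∈W (x∈∁p⇒x∉p (p∩q⊆q C (∁ W) (C⊆C∖W (W⊆C w∈W))))
      where
      ∂C∖W⊆X : ∂ (C ∩ ∁ W) ⊆ X
      ∂C∖W⊆X {z} z∈∂ with ∂⁻ {U = C ∩ ∁ W} z∈∂
      ... | z∉ , u , u∈ , uz with x∈p∩q⁻ C (∁ W) u∈ | z ∈? C
      ...   | u∈C , u∉W | no  z∉C = ∂C⊆X (∂⁺ z∉C u∈C uz)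
      ...   | u∈C , u∉W | yes z∈C with z ∈? W
      ...     | yes z∈W = contradiction (∂W⊆X (∂⁺ (x∈∁p⇒x∉p u∉W) z∈W (Adj-sym uz))) (C∩X=∅ u u∈C)
      ...     | no  z∉W = contradiction (x∈p∩q⁺ (z∈C , x∉p⇒x∈∁p z∉W)) z∉

      C⊆C∖W : C ⊆ C ∩ ∁ W
      C⊆C∖W = ⊆∧∣∣≥⇒⊇ (p∩q⊆p C (∁ W)) (min (C ∩ ∁ W)
        (x∈p∩q⁺ (v∈C , x∉p⇒x∈∁p v∉W) , (λ x x∈ → C∩X=∅ x (p∩q⊆p C (∁ W) x∈)) , ∂C∖W⊆X))

  ∂∪⁻ : ∀ {z} → z ∈ ∂ (U ∪ W) → z ∈ ∂ U ⊎ z ∈ ∂ W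
  ∂∪⁻ {U} {W} z∈ with ∂⁻ {U = U ∪ W} z∈
  ... | z∉ , u , u∈ , uz with x∈p∪q⁻ U W u∈
  ...   | inj₁ u∈U = inj₁ (∂⁺ (z∉ ∘ p⊆p∪q W) u∈U uz)
  ...   | inj₂ u∈W = inj₂ (∂⁺ (z∉ ∘ q⊆p∪q U W) u∈W uz)

  ∣∂∣-submodular : ∀ U W → ∣ ∂ (U ∪ W) ∣ + ∣ ∂ (U ∩ W) ∣ ≤ ∣ ∂ U ∣ + ∣ ∂ W ∣
  ∣∂∣-submodular U W = ∣∣-exchange′ {p = ∂ (U ∪ W)} {∂ (U ∩ W)} {∂ U} {∂ W} (∂∪⁻ {U} {W}) ∂∩ both
    where
    ∂∩ : ∀ {z} → z ∈ ∂ (U ∩ W) → z ∈ ∂ U ⊎ z ∈ ∂ W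
    ∂∩ {z} z∈ with ∂⁻ {U = U ∩ W} z∈
    ... | z∉ , u , u∈ , uz with x∈p∩q⁻ U W u∈ | z ∈? U
    ...   | u∈U , u∈W | no  z∉U = inj₁ (∂⁺ z∉U u∈U uz)
    ...   | u∈U , u∈W | yes z∈U = inj₂ (∂⁺ (λ z∈W → z∉ (x∈p∩q⁺ (z∈U , z∈W))) u∈W uz)

    both : ∀ {z} → z ∈ ∂ (U ∪ W) → z ∈ ∂ (U ∩ W) → z ∈ ∂ U × z ∈ ∂ W
    both z∈∪ z∈∩ with ∂⁻ {U = U ∪ W} z∈∪ | ∂⁻ {U = U ∩ W} z∈∩
    ... | z∉ , _ | _ , u , u∈ , uz = let u∈U , u∈W = x∈p∩q⁻ U W u∈ in
      ∂⁺ (z∉ ∘ p⊆p∪q W) u∈U uz , ∂⁺ (z∉ ∘ q⊆p∪q U W) u∈W uz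

  -- This replaces submodularity when the intersection is empty. A common vertex of the closed
  -- neighbourhoods lies in at least one of the two boundaries, and in both if it is outside
  -- `U ∪ W`.
  ∣∂∣-disjoint : Disjoint U W → ∣ ∂ (U ∪ W) ∣ + ∣ N[ U ] ∩ N[ W ] ∣ ≤ ∣ ∂ U ∣ + ∣ ∂ W ∣
  ∣∂∣-disjoint {U} {W} U∩W=∅ = ∣∣-exchange′ {p = ∂ (U ∪ W)} {N[ U ] ∩ N[ W ]} {∂ U} {∂ W} (∂∪⁻ {U} {W}) I both
    where
    I : ∀ {z} → z ∈ N[ U ] ∩ N[ W ] → z ∈ ∂ U ⊎ z ∈ ∂ W
    I {z} z∈ with x∈p∩q⁻ N[ U ] N[ W ] z∈ | z ∈? U
    ... | z∈NU , z∈NW | yes z∈U = inj₂ (N∖⇒∂ z∈NW (U∩W=∅ z z∈U))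
    ... | z∈NU , z∈NW | no  z∉U = inj₁ (N∖⇒∂ z∈NU z∉U)

    both : ∀ {z} → z ∈ ∂ (U ∪ W) → z ∈ N[ U ] ∩ N[ W ] → z ∈ ∂ U × z ∈ ∂ W
    both z∈∂ z∈ = let z∈NU , z∈NW = x∈p∩q⁻ N[ U ] N[ W ] z∈ ; z∉ = ∂⇒∉ {U = U ∪ W} z∈∂ in
      N∖⇒∂ z∈NU (z∉ ∘ p⊆p∪q W) , N∖⇒∂ z∈NW (z∉ ∘ q⊆p∪q U W)

  module _ {j : ℕ} (connected : Connected G j) where

    ∣∂∣-large : ∀ Q → Nonempty Q → Nonempty (opp Q) → j ≤ ∣ ∂ Q ∣
    ∣∂∣-large Q (x , x∈Q) (y , y∈opp) = ℕ.≮⇒≥ λ ∂<j →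
      proj₂ connected (∂ Q) ∂<j (x , y , boundary-separates x∈Q y∈opp)

    -- If no such side existed, adding `v` to `X` would give a larger unsplittable set, against
    -- maximality.
    outside-separable : Block (suc j) X → v ∉ X → ∃[ U ] (v ∈ U × Disjoint U X × ∣ ∂ U ∣ ≤ j)
    outside-separable {X} {v} ((size , uns) , max) v∉X
      with anySubset? (λ U → v ∈? U ×-dec (disjoint? U X ×-dec (∣ ∂ U ∣ ℕ.≤? j)))
    ... | yes sep = sep
    ... | no ∄U = contradiction
      (max Y (ℕ.≤-trans size (p⊆q⇒∣p∣≤∣q∣ X⊆Y)) unsY X⊆Y (q⊆p∪q X ⁅ v ⁆ (x∈⁅x⁆ v))) v∉X
      where
      Y = X ∪ ⁅ v ⁆
      X⊆Y : X ⊆ Y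
      X⊆Y = p⊆p∪q ⁅ v ⁆

      avoided : ∀ U → v ∈ U → ∣ ∂ U ∣ ≤ j → ¬ (∃[ x ] (x ∈ X × x ∉ N[ U ]))
      avoided U v∈U ∂U≤j (x , x∈X , x∉N) = ∄U (U , v∈U , (λ z z∈U z∈X →
        x∉N (uns U (s≤s ∂U≤j) (z , x∈p∩q⁺ (z∈X , z∈U)) x∈X)) , ∂U≤j)

      unsY : Unsplit (suc j) Y
      unsY U (s≤s ∂U≤j) (x , x∈) {y} y∈Y with y ∈? N[ U ] | x∈p∩q⁻ Y U x∈
      ... | yes y∈N | _ = y∈N
      ... | no  y∉N | x∈Y , x∈U with x∈p∪q⁻ X ⁅ v ⁆ x∈Y | x∈p∪q⁻ X ⁅ v ⁆ y∈Y
      ...   | inj₁ x∈X | inj₁ y∈X = uns U (s≤s ∂U≤j) (x , x∈p∩q⁺ (x∈X , x∈U)) y∈X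
      ...   | inj₂ x∈v | inj₁ y∈X = case x∈⁅y⁆⇒x≡y v x∈v of λ { refl →
        contradiction (y , y∈X , y∉N) (avoided U x∈U ∂U≤j) }
      ...   | inj₂ x∈v | inj₂ y∈v =
        subst (_∈ N[ U ]) (trans (x∈⁅y⁆⇒x≡y v x∈v) (sym (x∈⁅y⁆⇒x≡y v y∈v))) (⊆N x∈U)
      -- Here `v` lies on the far side of `U`, so `opp U` serves as the side around `v`; its
      -- boundary is no larger.
      ...   | inj₁ x∈X | inj₂ y∈v = case x∈⁅y⁆⇒x≡y v y∈v of λ { refl →
        contradiction (x , x∈X , λ x∈N → opp⁻ (⊆opp-swap {opp U} id x∈U) x∈N)
          (avoided (opp U) (opp⁺ y∉N) (ℕ.≤-trans (p⊆q⇒∣p∣≤∣q∣ ∂opp⊆∂) ∂U≤j)) }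

    opp-nonempty : suc j ≤ ∣ X ∣ → Disjoint U X → ∣ ∂ U ∣ ≤ j → ∃[ x ] (x ∈ X × x ∈ opp U)
    opp-nonempty {U = U} size U∩X=∅ ∂U≤j =
      let x , x∈X , x∉∂U = ∣∣<⇒∃ {p = ∂ U} (ℕ.≤-trans (s≤s ∂U≤j) size) in
      x , x∈X , opp⁺ (λ x∈N → [ (λ x∈U → U∩X=∅ x x∈U x∈X) , x∉∂U ]′ (N⁻ x∈N))

    module _ (edges : EdgeCondition j G) where

      -- Either `∂ (U ∩ W)` or the common part of the closed neighbourhoods has at least `j`
      -- vertices, which are subtracted from a total of at most 2j. In the first case `X` supplies
      -- the vertex beyond `U ∩ W` that connectedness requires.
      uncross : suc j ≤ ∣ X ∣ → Disjoint U X → ∣ ∂ U ∣ ≤ j → ∣ ∂ W ∣ ≤ j →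
                v ∈ U → w ∈ W → Adj v w → ∣ ∂ (U ∪ W) ∣ ≤ j
      uncross {X} {U} {W} size U∩X=∅ ∂U≤j ∂W≤j v∈U w∈W vw with nonempty? (U ∩ W)
      ... | yes U∩W≠∅ = ℕ.+-cancelʳ-≤ j _ _ (begin
        ∣ ∂ (U ∪ W) ∣ + j               ≤⟨ ℕ.+-monoʳ-≤ _ (∣∂∣-large (U ∩ W) U∩W≠∅ opp≠∅) ⟩
        ∣ ∂ (U ∪ W) ∣ + ∣ ∂ (U ∩ W) ∣   ≤⟨ ∣∂∣-submodular U W ⟩
        ∣ ∂ U ∣ + ∣ ∂ W ∣               ≤⟨ ℕ.+-mono-≤ ∂U≤j ∂W≤j ⟩
        j + j                           ∎)
        where
        open ℕ.≤-Reasoning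
        opp≠∅ : Nonempty (opp (U ∩ W))
        opp≠∅ = let x , _ , x∈opp = opp-nonempty size U∩X=∅ ∂U≤j in x , opp-anti (p∩q⊆p U W) x∈opp
      ... | no  U∩W=∅ = ℕ.+-cancelʳ-≤ j _ _ (begin
        ∣ ∂ (U ∪ W) ∣ + j                     ≤⟨ ℕ.+-monoʳ-≤ _ (∣I∣-large ∂U≤j ∂W≤j (edges _ _ vw)) ⟩
        ∣ ∂ (U ∪ W) ∣ + ∣ N[ U ] ∩ N[ W ] ∣   ≤⟨ ∣∂∣-disjoint disj ⟩
        ∣ ∂ U ∣ + ∣ ∂ W ∣                     ≤⟨ ℕ.+-mono-≤ ∂U≤j ∂W≤j ⟩
        j + j                                 ∎)
        where
        open ℕ.≤-Reasoning
        disj : Disjoint U W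
        disj x x∈U x∈W = U∩W=∅ (x , x∈p∩q⁺ (x∈U , x∈W))
        open Linkage G disj v∈U w∈W vw

      -- Minimising the complement yields a largest admissible `U` meeting `C`. A vertex of `C` in
      -- `∂ U` would allow `U` to be enlarged by uncrossing. So `C` avoids `∂ U`, lies in `U`, and
      -- `∂ C`, being in `X`, lies in `∂ U`.
      ∣∂component∣ : Block (suc j) X → Component X C → ∣ ∂ C ∣ ≤ j
      ∣∂component∣ {X} {C} block@((size , _) , _) comp@((v , v∈C) , (C∩X=∅ , ∂C⊆X) , _) =
        let U₀ , v∈U₀ , U₀∩X=∅ , ∂U₀≤j = outside-separable block (C∩X=∅ v v∈C)
            U , good , max = minimum P? (∣_∣ ∘ ∁) (U₀ , U₀∩X=∅ , ∂U₀≤j , v , x∈p∩q⁺ (v∈U₀ , v∈C))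
        in bound U good (λ W → max W)
        where
        P : Subset n → Set
        P U = Disjoint U X × ∣ ∂ U ∣ ≤ j × Nonempty (U ∩ C)

        P? : Decidable P
        P? U = disjoint? U X ×-dec ((∣ ∂ U ∣ ℕ.≤? j) ×-dec nonempty? (U ∩ C))

        bound : ∀ U → P U → (∀ W → P W → ∣ ∁ U ∣ ≤ ∣ ∁ W ∣) → ∣ ∂ C ∣ ≤ j
        bound U (U∩X=∅ , ∂U≤j , x , x∈) max with any? (λ w → w ∈? C ×-dec w ∈? ∂ U)
        ... | no C∩∂U=∅ = ℕ.≤-trans (p⊆q⇒∣p∣≤∣q∣ ∂C⊆∂U) ∂U≤j
          where
          C⊆U : C ⊆ U
          C⊆U = component-connected comp (λ z z∈C z∈∂ → C∩∂U=∅ (z , z∈C , z∈∂)) (p∩q⊆q U C x∈) (p∩q⊆p U C x∈)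
          ∂C⊆∂U : ∂ C ⊆ ∂ U
          ∂C⊆∂U z∈∂ = N∖⇒∂ (N-mono C⊆U (∂⊆N z∈∂)) (λ z∈U → U∩X=∅ _ z∈U (∂C⊆X z∈∂))
        ... | yes (w , w∈C , w∈∂U) =
          let w∉U , u , u∈U , uw = ∂⁻ {U = U} w∈∂U
              W , w∈W , W∩X=∅ , ∂W≤j = outside-separable block (C∩X=∅ w w∈C)
          in contradiction
               (p⊂q⇒∣p∣<∣q∣ (p⊂q⇒∁p⊃∁q (p⊆p∪q {p = U} W , w , q⊆p∪q U W w∈W , w∉U)))
               (ℕ.≤⇒≯ (max (U ∪ W)
                 ( (λ z z∈ → [ U∩X=∅ z , W∩X=∅ z ]′ (x∈p∪q⁻ U W z∈))
                 , uncross size U∩X=∅ ∂U≤j ∂W≤j u∈U w∈W uw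
                 , x , x∈p∩q⁺ (p⊆p∪q W (p∩q⊆p U C x∈) , p∩q⊆q U C x∈))))

-- Nestedness

module Nestedness (G : Graph n) {j : ℕ} (connected : Connected G j) (edges : EdgeCondition j G) where
  open Boundary G
  open Components G

  private
    variable
      U W X X′ C C′ : Subset n
      v w : Fin n

  -- Proper separations of order at most `j`; by connectedness their order is exactly `j`.
  Tight : Subset n → Set
  Tight U = ∣ ∂ U ∣ ≤ j × Nonempty U × Nonempty (opp U)

  tight? : Decidable Tight
  tight? U = (∣ ∂ U ∣ ℕ.≤? j) ×-dec (nonempty? U ×-dec nonempty? (opp U))

  ⊆opp² : U ⊆ opp (opp U)
  ⊆opp² {U} = ⊆opp-swap {W = opp U} id

  -- `∂ (opp U)` is contained in `∂ U` and, by connectedness, has at least `j` vertices. The two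
  -- boundaries are therefore equal, and `opp` is an involution on tight sides.
  opp²⊆ : Tight U → opp (opp U) ⊆ U
  opp²⊆ {U} (∂U≤j , (u , u∈U) , opp≠∅) {v} v∈ with v ∈? U | v ∈? ∂ U
  ... | yes v∈U | _ = v∈U
  ... | no  v∉U | no  v∉∂ = contradiction (⊆N (opp⁺ (λ v∈N → v∉∂ (N∖⇒∂ v∈N v∉U)))) (opp⁻ v∈)
  ... | no  v∉U | yes v∈∂ = contradiction (∂⊆N (∂U⊆ v∈∂)) (opp⁻ v∈)
    where
    ∂U⊆ : ∂ U ⊆ ∂ (opp U)
    ∂U⊆ = ⊆∧∣∣≥⇒⊇ ∂opp⊆∂ (ℕ.≤-trans ∂U≤j (∣∂∣-large connected (opp U) opp≠∅ (u , ⊆opp² u∈U)))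

  tight-opp : Tight U → Tight (opp U)
  tight-opp (∂U≤j , (u , u∈U) , opp≠∅) =
    ℕ.≤-trans (p⊆q⇒∣p∣≤∣q∣ ∂opp⊆∂) ∂U≤j , opp≠∅ , u , ⊆opp² u∈U

  tight-component : Block (suc j) X → Component X C → Tight C
  tight-component block@((size , _) , _) comp@(C≠∅ , (C∩X=∅ , _) , _) =
    let ∂C≤j = ∣∂component∣ connected edges block comp
        x , _ , x∈opp = opp-nonempty connected size C∩X=∅ ∂C≤j
    in ∂C≤j , C≠∅ , x , x∈opp

  Nested : Subset n → Subset n → Set
  Nested U W = (U ⊆ W) ⊎ (U ⊆ opp W) ⊎ (opp U ⊆ W) ⊎ (opp U ⊆ opp W)

  nested-swap : Tight U → Nested U W → Nested W U
  nested-swap tU (inj₁ U⊆W)                 = inj₂ (inj₂ (inj₂ (opp-anti U⊆W)))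
  nested-swap tU (inj₂ (inj₁ U⊆oW))         = inj₂ (inj₁ (⊆opp-swap U⊆oW))
  nested-swap tU (inj₂ (inj₂ (inj₁ oU⊆W)))  = inj₂ (inj₂ (inj₁ (⊆-trans (opp-anti oU⊆W) (opp²⊆ tU))))
  nested-swap tU (inj₂ (inj₂ (inj₂ oU⊆oW))) = inj₁ (⊆-trans (⊆opp-swap oU⊆oW) (opp²⊆ tU))

  nested-oppˡ : Nested (opp U) W → Nested U W
  nested-oppˡ (inj₁ oU⊆W)                 = inj₂ (inj₂ (inj₁ oU⊆W))
  nested-oppˡ (inj₂ (inj₁ oU⊆oW))         = inj₂ (inj₂ (inj₂ oU⊆oW))
  nested-oppˡ (inj₂ (inj₂ (inj₁ ooU⊆W)))  = inj₁ (⊆-trans ⊆opp² ooU⊆W)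
  nested-oppˡ (inj₂ (inj₂ (inj₂ ooU⊆oW))) = inj₂ (inj₁ (⊆-trans ⊆opp² ooU⊆oW))

  nested-oppʳ : Tight U → Tight W → Nested U (opp W) → Nested U W
  nested-oppʳ tU tW = nested-swap tW ∘ nested-oppˡ ∘ nested-swap tU

  block-side : Block (suc j) X → ∣ ∂ U ∣ ≤ j → Disjoint X U ⊎ X ⊆ N[ U ]
  block-side {X} {U} ((_ , uns) , _) ∂U≤j with nonempty? (X ∩ U)
  ... | yes X∩U≠∅ = inj₂ (uns U (s≤s ∂U≤j) X∩U≠∅)
  ... | no  X∩U=∅ = inj₁ (λ x x∈X x∈U → X∩U=∅ (x , x∈p∩q⁺ (x∈X , x∈U)))

  component-nested : Component X C → Disjoint C (∂ C′) → Nested C C′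
  component-nested {C = C} {C′} comp C∩∂=∅ with nonempty? (C ∩ C′)
  ... | yes (v , v∈) = inj₁ (component-connected comp C∩∂=∅ (p∩q⊆p C C′ v∈) (p∩q⊆q C C′ v∈))
  ... | no  C∩C′=∅ = inj₂ (inj₁ (λ {v} v∈C → opp⁺ (λ v∈N →
    [ (λ v∈C′ → C∩C′=∅ (v , x∈p∩q⁺ (v∈C , v∈C′))) , C∩∂=∅ v v∈C ]′ (N⁻ v∈N))))

  module _ (blockX : Block (suc j) X) (blockX′ : Block (suc j) X′)
           (comp : Component X C) (comp′ : Component X′ C′) where
    private
      tC′ : Tight C′
      tC′ = tight-component blockX′ comp′

    nested-inside : Disjoint X′ C → Nested C C′
    nested-inside X′∩C=∅ = component-nested comp
      (λ z z∈C z∈∂C′ → X′∩C=∅ z (proj₂ (proj₁ (proj₂ comp′)) z∈∂C′) z∈C)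

    -- If the corner `Q` is nonempty, each boundary vertex of it lies in both `∂ C` and `∂ C′`,
    -- because each block lies in the closed neighbourhood of the other component. Connectedness
    -- makes `∂ Q` as large as `∂ C′`, so `∂ C′` lies in `∂ C` and misses `C`.
    nested-outside : X ⊆ N[ C′ ] → X′ ⊆ N[ C ] → Nested C C′
    nested-outside X⊆NC′ X′⊆NC with opp C ⊆? C′
    ... | yes oC⊆C′ = inj₂ (inj₂ (inj₁ oC⊆C′))
    ... | no  oC⊈C′ = component-nested comp C∩∂C′=∅
      where
      Q : Subset n
      Q = opp C ∩ opp C′

      ∂C⊆X : ∂ C ⊆ X
      ∂C⊆X = proj₂ (proj₁ (proj₂ comp))
      ∂C′⊆X′ : ∂ C′ ⊆ X′
      ∂C′⊆X′ = proj₂ (proj₁ (proj₂ comp′))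

      Q≠∅ : Nonempty Q
      Q≠∅ = let v , v∈oC , v∉C′ = ⊈⇒∃ oC⊈C′ in
        v , x∈p∩q⁺ (v∈oC , opp⁺ (λ v∈N →
          opp⁻ v∈oC (X′⊆NC (∂C′⊆X′ (N∖⇒∂ v∈N v∉C′)))))

      oppQ≠∅ : Nonempty (opp Q)
      oppQ≠∅ = let c , c∈C = proj₁ comp in c , opp-anti (p∩q⊆p (opp C) (opp C′)) (⊆opp² c∈C)

      ∂Q⊆ : ∀ {z} → z ∈ ∂ Q → z ∈ ∂ C × z ∈ ∂ C′
      ∂Q⊆ {z} z∈∂ with ∂⁻ {U = Q} z∈∂
      ... | z∉Q , u , u∈Q , uz = in-both
        where
        open Graph G using () renaming (sym to Adj-sym)
        z∉C : z ∉ C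
        z∉C z∈C = opp⁻ (p∩q⊆p (opp C) (opp C′) u∈Q) (adj⇒N z∈C (Adj-sym uz))
        z∉C′ : z ∉ C′
        z∉C′ z∈C′ = opp⁻ (p∩q⊆q (opp C) (opp C′) u∈Q) (adj⇒N z∈C′ (Adj-sym uz))
        in-both : z ∈ ∂ C × z ∈ ∂ C′
        in-both with z ∈? N[ C ] | z ∈? N[ C′ ]
        ... | yes z∈N | _ = let z∈∂C = N∖⇒∂ z∈N z∉C in z∈∂C , N∖⇒∂ (X⊆NC′ (∂C⊆X z∈∂C)) z∉C′
        ... | no  _   | yes z∈N = let z∈∂C′ = N∖⇒∂ z∈N z∉C′ in N∖⇒∂ (X′⊆NC (∂C′⊆X′ z∈∂C′)) z∉C , z∈∂C′
        ... | no  z∉N | no z∉N′ = contradiction (x∈p∩q⁺ (opp⁺ z∉N , opp⁺ z∉N′)) z∉Q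

      ∂C′⊆∂Q : ∂ C′ ⊆ ∂ Q
      ∂C′⊆∂Q = ⊆∧∣∣≥⇒⊇ (proj₂ ∘ ∂Q⊆)
        (ℕ.≤-trans (proj₁ tC′) (∣∂∣-large connected Q Q≠∅ oppQ≠∅))

      C∩∂C′=∅ : Disjoint C (∂ C′)
      C∩∂C′=∅ z z∈C z∈∂C′ = ∂⇒∉ (proj₁ (∂Q⊆ (∂C′⊆∂Q z∈∂C′))) z∈C

  nested-components : Block (suc j) X → Block (suc j) X′ → Component X C → Component X′ C′ → Nested C C′
  nested-components blockX blockX′ comp comp′
    with tight-component blockX comp | tight-component blockX′ comp′
  ... | tC@(∂C≤j , _) | tC′@(∂C′≤j , _) with block-side blockX′ ∂C≤j | block-side blockX ∂C′≤j
  ...   | inj₁ X′∩C=∅ | _           = nested-inside blockX blockX′ comp comp′ X′∩C=∅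
  ...   | inj₂ _      | inj₁ X∩C′=∅ = nested-swap tC′ (nested-inside blockX′ blockX comp′ comp X∩C′=∅)
  ...   | inj₂ X′⊆NC  | inj₂ X⊆NC′  = nested-outside blockX blockX′ comp comp′ X⊆NC′ X′⊆NC

  BlockSide : Subset n → Set
  BlockSide U = Tight U × ∃[ X ] (Block (suc j) X × (Component X U ⊎ Component X (opp U)))

  nested-sides : BlockSide U → BlockSide W → Nested U W
  nested-sides {U} {W} (tU , X , bX , cU) (tW , X′ , bX′ , cW) with cU | cW
  ... | inj₁ cU | inj₁ cW = nested-components bX bX′ cU cW
  ... | inj₂ cU | inj₁ cW = nested-oppˡ (nested-components bX bX′ cU cW)
  ... | inj₁ cU | inj₂ cW = nested-oppʳ tU tW (nested-components bX bX′ cU cW)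
  ... | inj₂ cU | inj₂ cW = nested-oppˡ (nested-oppʳ (tight-opp tU) tW (nested-components bX bX′ cU cW))

  -- Keeping the smaller side of each separation is a symmetric choice of a root:
  -- all nodes then point away from ⊤.  A tie contributes both sides.
  Node : Subset n → Set
  Node U = ⊤ ⊆ U ⊎ (BlockSide U × ∣ U ∣ ≤ ∣ opp U ∣)

  node? : Decidable Node
  node? U = (⊤ ⊆? U) ⊎-dec ((tight? U ×-dec anySubset? (λ X → block? (suc j) X ×-dec
              (component? X U ⊎-dec component? X (opp U)))) ×-dec (∣ U ∣ ℕ.≤? ∣ opp U ∣))

  laminar : Node U → Node W → U ⊆ W ⊎ W ⊆ U ⊎ W ⊆ opp U
  laminar (inj₁ ⊤⊆U) _ = inj₂ (inj₁ (λ _ → ⊤⊆U ∈⊤))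
  laminar _ (inj₁ ⊤⊆W) = inj₁ (λ _ → ⊤⊆W ∈⊤)
  laminar {U} {W} (inj₂ (sU@(tU , _) , U≤)) (inj₂ (sW@(tW , _) , W≤)) with nested-sides sU sW
  ... | inj₁ U⊆W                 = inj₁ U⊆W
  ... | inj₂ (inj₁ U⊆oW)         = inj₂ (inj₂ (⊆opp-swap U⊆oW))
  ... | inj₂ (inj₂ (inj₂ oU⊆oW)) = inj₂ (inj₁ (⊆-trans (⊆opp-swap oU⊆oW) (opp²⊆ tU)))
  -- Two smaller sides can satisfy this only in a tie: the chain of sizes closes up and forces `W`
  -- to equal `opp U`.
  ... | inj₂ (inj₂ (inj₁ oU⊆W))  = inj₂ (inj₂ (⊆∧∣∣≥⇒⊇ oU⊆W (begin
        ∣ W ∣      ≤⟨ W≤ ⟩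
        ∣ opp W ∣  ≤⟨ p⊆q⇒∣p∣≤∣q∣ (⊆-trans (opp-anti oU⊆W) (opp²⊆ tU)) ⟩
        ∣ U ∣      ≤⟨ U≤ ⟩
        ∣ opp U ∣  ∎)))
    where open ℕ.≤-Reasoning

  node-∂ : Node U → ∣ ∂ U ∣ ≤ j
  node-∂ {U} (inj₁ ⊤⊆U) = ℕ.≤-trans (p⊆q⇒∣p∣≤∣q∣ {p = ∂ U} {⊥} (λ v∈∂ → contradiction (⊤⊆U ∈⊤) (∂⇒∉ v∈∂)))
                              (subst (_≤ j) (sym (∣⊥∣≡0 n)) z≤n)
  node-∂ (inj₂ ((( ∂U≤j , _) , _) , _)) = ∂U≤j

  node-nonempty : Node U → Nonempty U
  node-nonempty (inj₂ (((_ , U≠∅ , _) , _) , _)) = U≠∅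
  node-nonempty (inj₁ ⊤⊆U) = let x , _ = nonempty-Fin (proj₁ connected) in x , ⊤⊆U ∈⊤
    where
    nonempty-Fin : ∀ {l n} → l < n → Nonempty (⊤ {n})
    nonempty-Fin {n = suc n} _ = zero , ∈⊤

-- Tree-decompositions from laminar families

subsets : ∀ n → List (Subset n)
subsets zero    = Vec.[] ∷ []
subsets (suc n) = List.map (true Vec.∷_) (subsets n) List.++ List.map (false Vec.∷_) (subsets n)

∈-subsets : ∀ (U : Subset n) → U ∈ˡ subsets n
∈-subsets Vec.[]            = here refl
∈-subsets (true Vec.∷ U)  = ∈-++⁺ˡ (∈-map⁺ _ (∈-subsets U))
∈-subsets (false Vec.∷ U) = ∈-++⁺ʳ _ (∈-map⁺ _ (∈-subsets U))

subsets-unique : ∀ n → Unique (subsets n)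
subsets-unique zero    = [] ∷ []
subsets-unique (suc n) = Unique.++⁺
  (Unique.map⁺ ∷-injectiveʳ (subsets-unique n))
  (Unique.map⁺ ∷-injectiveʳ (subsets-unique n))
  λ (U∈ , U∈′) → case ∈-map⁻ _ U∈ , ∈-map⁻ _ U∈′ of λ { ((_ , _ , refl) , (_ , _ , ())) }

lookup-injective : ∀ {A : Set} {xs : List A} → Unique xs → ∀ s t → List.lookup xs s ≡ List.lookup xs t → s ≡ t
lookup-injective (_ ∷ _)   zero    zero    eq = refl
lookup-injective (x∉ ∷ _)  zero    (suc t) eq = contradiction eq (All.lookup x∉ (∈-lookup t))
lookup-injective (x∉ ∷ _)  (suc s) zero    eq = contradiction (sym eq) (All.lookup x∉ (∈-lookup s))
lookup-injective (_ ∷ xs!) (suc s) (suc t) eq = cong suc (lookup-injective xs! s t eq)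

-- Images of sets and boundaries under automorphisms.

module Image (α : Permutation′ n) where

  image⁺ : ∀ {U v} → v ∈ U → α ⟨$⟩ʳ v ∈ image α U
  image⁺ {U} {v} v∈U = lookup⇒[]= _ _ (trans (lookup∘tabulate _ (α ⟨$⟩ʳ v))
    (trans (cong (Vec.lookup U) (inverseˡ α)) ([]=⇒lookup v∈U)))

  image⁻ : ∀ {U v} → v ∈ image α U → α ⟨$⟩ˡ v ∈ U
  image⁻ {U} {v} v∈ = lookup⇒[]= _ _ (trans (sym (lookup∘tabulate _ v)) ([]=⇒lookup v∈))

  image⁺ˡ : ∀ {U v} → α ⟨$⟩ˡ v ∈ U → v ∈ image α U
  image⁺ˡ {U} v∈U = subst (_∈ image α U) (inverseʳ α) (image⁺ v∈U)

  image-mono : ∀ {U W} → U ⊆ W → image α U ⊆ image α W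
  image-mono U⊆W v∈ = image⁺ˡ (U⊆W (image⁻ v∈))

  image-flip : ∀ U → image α (image (flip α) U) ≡ U
  image-flip U = ⊆-antisym (λ v∈ → subst (_∈ U) (inverseʳ α) (flip⁻ (image⁻ v∈)))
                           (λ v∈U → image⁺ˡ (flip⁺ v∈U))
    where
    flip⁻ : ∀ {v} → v ∈ image (flip α) U → α ⟨$⟩ʳ v ∈ U
    flip⁻ {v} v∈ = lookup⇒[]= _ _ (trans (sym (lookup∘tabulate _ v)) ([]=⇒lookup v∈))
    flip⁺ : ∀ {v} → v ∈ U → α ⟨$⟩ˡ v ∈ image (flip α) U
    flip⁺ {v} v∈U = lookup⇒[]= _ _ (trans (lookup∘tabulate _ (α ⟨$⟩ˡ v))
      (trans (cong (Vec.lookup U) (inverseʳ α)) ([]=⇒lookup v∈U)))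

flip-automorphism : ∀ {G : Graph n} α → IsAutomorphism G α → IsAutomorphism G (flip α)
flip-automorphism {G = G} α aut x y = mk⇔
  (λ xy → Equivalence.from (aut _ _) (subst₂ Adj (sym (inverseʳ α)) (sym (inverseʳ α)) xy))
  (λ xy → subst₂ Adj (inverseʳ α) (inverseʳ α) (Equivalence.to (aut _ _) xy))
  where open Graph G using (Adj)

module ImageBoundary {G : Graph n} (α : Permutation′ n) (aut : IsAutomorphism G α) where
  open Graph G using (Adj)
  open Boundary G
  open Image α

  image-∂ : ∀ U → ∂ (image α U) ≡ image α (∂ U)
  image-∂ U = ⊆-antisym ⊆im im⊆
    where
    ⊆im : ∂ (image α U) ⊆ image α (∂ U)
    ⊆im v∈ = let v∉ , u , u∈ , uv = ∂⁻ v∈ in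
      image⁺ˡ (∂⁺ (v∉ ∘ image⁺ˡ) (image⁻ u∈) (Equivalence.to (flip-automorphism {G = G} α aut _ _) uv))
    im⊆ : image α (∂ U) ⊆ ∂ (image α U)
    im⊆ v∈ = let v∉ , u , u∈ , uv = ∂⁻ (image⁻ v∈) in
      ∂⁺ (v∉ ∘ image⁻) (image⁺ u∈) (subst (Adj _) (inverseʳ α) (Equivalence.to (aut _ _) uv))

  image-N⁺ : ∀ {U v} → α ⟨$⟩ˡ v ∈ N[ U ] → v ∈ N[ image α U ]
  image-N⁺ {U} v∈ = case N⁻ v∈ of λ where
    (inj₁ v∈U) → ⊆N (image⁺ˡ v∈U)
    (inj₂ v∈∂) → ∂⊆N (subst (_ ∈_) (sym (image-∂ U)) (image⁺ˡ v∈∂))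

  image-N⁻ : ∀ {U v} → v ∈ N[ image α U ] → α ⟨$⟩ˡ v ∈ N[ U ]
  image-N⁻ {U} v∈ = case N⁻ v∈ of λ where
    (inj₁ v∈U) → ⊆N (image⁻ v∈U)
    (inj₂ v∈∂) → ∂⊆N (image⁻ (subst (_ ∈_) (image-∂ U) v∈∂))

  image-opp : ∀ U → opp (image α U) ≡ image α (opp U)
  image-opp U = ⊆-antisym (λ v∈ → image⁺ˡ {opp U} (opp⁺ {U = U} (opp⁻ {U = image α U} v∈ ∘ image-N⁺)))
                          (λ v∈ → opp⁺ {U = image α U} (opp⁻ {U = U} (image⁻ {opp U} v∈) ∘ image-N⁻))

-- The rooted tree of a laminar family and its parts.

record LaminarFamily (G : Graph n) : Set₁ where
  open Boundary G
  field
    Node      : Subset n → Set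
    node?     : Decidable Node
    ⊤-node    : Node ⊤
    nonempty  : ∀ {U} → Node U → Nonempty U
    laminar   : ∀ {U W} → Node U → Node W → U ⊆ W ⊎ W ⊆ U ⊎ W ⊆ opp U

module LaminarTree {G : Graph n} (F : LaminarFamily G) where
  open Boundary G
  open LaminarFamily F

  abstract
    order : ℕ
    order = length (List.filter node? (subsets n))

    set : Fin order → Subset n
    set = List.lookup (List.filter node? (subsets n))

    set-node : ∀ t → Node (set t)
    set-node t = proj₂ (∈-filter⁻ node? {xs = subsets n} (∈-lookup t))

    node-index : ∀ {U} → Node U → ∃[ t ] set t ≡ U
    node-index {U} node = let i = ∈-filter⁺ node? (∈-subsets U) node in index i , sym (lookup-index i)

    set-injective : ∀ {s t} → set s ≡ set t → s ≡ t
    set-injective = lookup-injective (Unique.filter⁺ node? (subsets-unique n)) _ _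

  record _⊑_ (s t : Fin order) : Set where
    constructor incl
    field ⊑⇒⊆ : set s ⊆ set t
  open _⊑_

  _⊑?_ : ∀ s t → Dec (s ⊑ t)
  s ⊑? t = map′ incl ⊑⇒⊆ (set s ⊆? set t)

  _⊏_ _⋖_ : Fin order → Fin order → Set
  s ⊏ t = s ⊑ t × ¬ (t ⊑ s)
  s ⋖ t = s ⊏ t × (∀ r → s ⊑ r → r ⊑ t → r ⊑ s ⊎ t ⊑ r)

  _⊏?_ : ∀ s t → Dec (s ⊏ t)
  s ⊏? t = (s ⊑? t) ×-dec ¬? (t ⊑? s)

  _⋖?_ : ∀ s t → Dec (s ⋖ t)
  s ⋖? t = (s ⊏? t) ×-dec all? (λ r → (s ⊑? r) →-dec ((r ⊑? t) →-dec
             ((r ⊑? s) ⊎-dec (t ⊑? r))))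

  private
    variable
      r s t x y : Fin order
      v : Fin n

  ⊑-antisym : s ⊑ t → t ⊑ s → s ≡ t
  ⊑-antisym (incl s⊆t) (incl t⊆s) = set-injective (⊆-antisym s⊆t t⊆s)

  ⊑-refl : s ⊑ s
  ⊑-refl = incl id

  ⊑-trans : r ⊑ s → s ⊑ t → r ⊑ t
  ⊑-trans (incl r⊆s) (incl s⊆t) = incl (⊆-trans r⊆s s⊆t)

  ⋢⇒∃ : ¬ (s ⊑ t) → ∃[ v ] (v ∈ set s × v ∉ set t)
  ⋢⇒∃ s⋢t = ⊈⇒∃ (λ s⊆t → s⋢t (incl s⊆t))

  touching : v ∈ N[ set s ] → v ∈ set t → s ⊑ t ⊎ t ⊑ s
  touching {s = s} {t} v∈N v∈t with laminar (set-node s) (set-node t)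
  ... | inj₁ s⊆t        = inj₁ (incl s⊆t)
  ... | inj₂ (inj₁ t⊆s) = inj₂ (incl t⊆s)
  ... | inj₂ (inj₂ t⊆)  = contradiction v∈N (opp⁻ (t⊆ v∈t))

  -- Members sharing the vertices of a nonempty `r` cannot be far apart. Hence the members above `r`
  -- form a chain, which makes parents unique.
  above-chain : r ⊑ s → r ⊑ t → s ⊑ t ⊎ t ⊑ s
  above-chain {r} (incl r⊆s) (incl r⊆t) =
    let _ , v∈r = nonempty (set-node r) in touching (⊆N (r⊆s v∈r)) (r⊆t v∈r)

  cover-unique : r ⋖ s → r ⋖ t → s ≡ t
  cover-unique {r} {s} {t} ((r⊑s , s⋢r) , cs) ((r⊑t , t⋢r) , ct) with above-chain r⊑s r⊑t
  ... | inj₁ s⊑t = [ (λ s⊑r → ⊥-elim (s⋢r s⊑r)) , ⊑-antisym s⊑t ]′ (ct s r⊑s s⊑t)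
  ... | inj₂ t⊑s = [ (λ t⊑r → ⊥-elim (t⋢r t⊑r)) , (λ s⊑t → ⊑-antisym s⊑t t⊑s) ]′ (cs t r⊑t t⊑s)

  minimal-node : {P : Subset n → Set} → Decidable P → ∃[ t ] P (set t) →
                 ∃[ t ] (P (set t) × (∀ s → P (set s) → ¬ (s ⊏ t)))
  minimal-node {P} P? (t , Pt) =
    let U , (nodeU , PU) , min = minimum (λ U → node? U ×-dec P? U) ∣_∣ (set t , set-node t , Pt)
        u , u≡U = node-index nodeU
    in u , subst P (sym u≡U) PU , λ s Ps (incl s⊆u , u⋢s) →
         ℕ.<⇒≱ (p⊂q⇒∣p∣<∣q∣ (s⊆u , ⋢⇒∃ u⋢s))
           (subst (λ W → ∣ W ∣ ≤ ∣ set s ∣) (sym u≡U) (min (set s) (set-node s , Ps)))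

  top : Fin order
  top = proj₁ (node-index ⊤-node)

  ∈top : v ∈ set top
  ∈top = subst (_ ∈_) (sym (proj₂ (node-index ⊤-node))) ∈⊤

  ⊑top : t ⊑ top
  ⊑top = incl (λ _ → ∈top)

  cover-exists : ¬ (top ⊑ t) → ∃[ s ] t ⋖ s
  cover-exists {t} top⋢t =
    let s , t⊏s , min = minimal-node (λ U → (set t ⊆? U) ×-dec ¬? (U ⊆? set t))
                        (top , (λ _ → ∈top) , λ top⊆t → top⋢t (incl top⊆t))
    in s , (incl (proj₁ t⊏s) , λ s⊑t → proj₂ t⊏s (⊑⇒⊆ s⊑t)) ,
       between s (λ r (t⊑r , r⋢t) → min r (⊑⇒⊆ t⊑r , λ r⊆t → r⋢t (incl r⊆t)))
    where
    between : ∀ s → (∀ r → t ⊏ r → ¬ (r ⊏ s)) → ∀ r → t ⊑ r → r ⊑ s → r ⊑ t ⊎ s ⊑ r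
    between s min r t⊑r r⊑s with r ⊑? t | s ⊑? r
    ... | yes r⊑t | _       = inj₁ r⊑t
    ... | no  _   | yes s⊑r = inj₂ s⊑r
    ... | no  r⋢t | no  s⋢r = contradiction (r⊑s , s⋢r) (min r (t⊑r , r⋢t))

  T : Graph order
  T = record
    { Adj    = λ s t → s ⋖ t ⊎ t ⋖ s
    ; Adj?   = λ s t → (s ⋖? t) ⊎-dec (t ⋖? s)
    ; sym    = [ inj₂ , inj₁ ]′
    ; irrefl = λ { refl → [ (λ ((t⊑t , t⋢t) , _) → t⋢t t⊑t) , (λ ((t⊑t , t⋢t) , _) → t⋢t t⊑t) ]′ }
    }

  open Graph T using () renaming (Adj to Adjᵀ; sym to Adjᵀ-sym)

  below : Fin order → Subset order
  below r = ⟪ (λ t → t ⊑? r) ⟫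

  below⁺ : t ⊑ r → t ∈ below r
  below⁺ {r = r} t⊑r = ∈⟪⟫⁺ (λ t → t ⊑? r) t⊑r

  below⁻ : t ∈ below r → t ⊑ r
  below⁻ {r = r} t∈ = ∈⟪⟫⁻ (λ t → t ⊑? r) t∈

  -- A down-set is joined to the rest of the tree only by the edge from its maximum to the parent.
  -- Acyclicity and the path condition on parts both rest on this cut.
  leaving : s ⊑ r → ¬ (t ⊑ r) → Adjᵀ s t → s ≡ r × r ⋖ t
  leaving s⊑r t⋢r (inj₂ ((t⊑s , _) , _)) = contradiction (⊑-trans t⊑s s⊑r) t⋢r
  leaving {s} {r} {t} s⊑r t⋢r (inj₁ s⋖t@((s⊑t , _) , c)) with above-chain s⊑r s⊑t
  ... | inj₂ t⊑r = ⊥-elim (t⋢r t⊑r)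
  ... | inj₁ r⊑t with c r s⊑r r⊑t
  ...   | inj₂ t⊑r = ⊥-elim (t⋢r t⊑r)
  ...   | inj₁ r⊑s with ⊑-antisym s⊑r r⊑s
  ...     | refl = refl , s⋖t

  -- The down-set of `x` can be entered only through `x`.
  stays-above : ∀ (q : Walk T s y) → ¬ (x ∈ˡ walkVertices T q) → ¬ (s ⊑ x) → ¬ (y ⊑ x)
  stays-above {x = x} q x∉q s⋢x y⊑x =
    let a , b , a∈ , b∉ , ab , a∈q , b∈q = Boundary.crossing T q (∁ (below x))
          (x∉p⇒x∈∁p (λ s∈ → s⋢x (below⁻ s∈))) (x∈p⇒x∉∁p (below⁺ y⊑x))
        b≡x , _ = leaving (below⁻ (x∉∁p⇒x∈p b∉)) (λ a⊑x → x∈∁p⇒x∉p a∈ (below⁺ a⊑x)) (Adjᵀ-sym ab)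
    in x∉q (subst (_∈ˡ walkVertices T q) b≡x b∈q)

  -- The down-set of `s` can be left only into the parent of `s`, which is `x`.
  stays-below : ∀ (q : Walk T s y) → ¬ (x ∈ˡ walkVertices T q) → s ⋖ x → y ⊑ s
  stays-below {s} {y} {x} q x∉q s⋖x with y ∈? below s
  ... | yes y∈ = below⁻ y∈
  ... | no  y∉ =
    let a , b , a∈ , b∉ , ab , _ , b∈q = Boundary.crossing T q (below s) (below⁺ ⊑-refl) y∉
        _ , s⋖b = leaving (below⁻ a∈) (λ b⊑s → b∉ (below⁺ b⊑s)) ab
    in contradiction (subst (_∈ˡ walkVertices T q) (cover-unique s⋖b s⋖x) b∈q) x∉q

  closed⇒top∈ : ∀ U → Boundary.∂ T U ⊆ ⊥ → t ∈ U → top ∈ U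
  closed⇒top∈ U closed t∈U = climb _ t∈U (<-wellFounded _)
    where
    climb : ∀ t → t ∈ U → Acc _<_ ∣ ∁ (set t) ∣ → top ∈ U
    climb t t∈U (acc rs) with top ⊑? t
    ... | yes top⊑t = subst (_∈ U) (⊑-antisym ⊑top top⊑t) t∈U
    ... | no  top⋢t = let s , t⋖s@((t⊑s , s⋢t) , _) = cover-exists {t} top⋢t in
      climb s (decidable-stable (s ∈? U) (λ s∉U → ∉⊥ (closed (Boundary.∂⁺ T s∉U t∈U (inj₁ t⋖s)))))
        (rs (p⊂q⇒∣p∣<∣q∣ (p⊂q⇒∁p⊃∁q (⊑⇒⊆ t⊑s , ⋢⇒∃ s⋢t))))

  -- If `s` were not linked to `t`, the set linked to `t` and its complement would both be closed
  -- under adjacency. Climbing along parents would put the root into both.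
  paths : ∀ s t → Path T s t
  paths s t with Boundary.reach T ⊥ t ∉⊥
  ... | U , t∈U , _ , closed , linked with s ∈? U
  ...   | yes s∈U = proj₁ (linked s∈U)
  ...   | no  s∉U = contradiction (closed⇒top∈ U closed t∈U)
    (x∈∁p⇒x∉p (closed⇒top∈ (∁ U)
      (λ v∈∂ → let v∉ , u , u∈ , uv = Boundary.∂⁻ T v∈∂ in
         ⊥-elim (∉⊥ (closed (Boundary.∂⁺ T (x∈∁p⇒x∉p u∈) (x∉∁p⇒x∈p v∉) (Adjᵀ-sym uv)))))
      (x∉p⇒x∈∁p s∉U)))

  -- On a cycle let `z` and `y` be the two neighbours of `x`. If `z` is the parent of `x`, the rest
  -- of the cycle stays outside the down-set of `x`, so `y` is the parent too. If `z` is a child,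
  -- the rest stays below `z`, and the edge from `y` to `x` can leave only from `z`. Both cases give
  -- `y` = `z`.
  acyclic : Acyclic T
  acyclic x y (ε , _) (s≤s ())
  acyclic x y (_◅_ {j = z} xz q , x∉q ∷ q!) 3≤ yx with xz
  ... | inj₁ x⋖z@((_ , z⋢x) , _) = y≢z (cover-unique x⋖y x⋖z)
    where
    y≢z : y ≢ z
    y≢z refl = ℕ.<⇒≱ (s≤s (s≤s (s≤s z≤n))) (subst (λ vs → 3 ≤ suc (length vs)) (closed-path T (q , q!)) 3≤)
    y⋢x : ¬ (y ⊑ x)
    y⋢x = stays-above q (λ x∈q → All.lookup x∉q x∈q refl) z⋢x
    x⋖y : x ⋖ y
    x⋖y = proj₂ (leaving ⊑-refl y⋢x (Adjᵀ-sym yx))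
  ... | inj₂ z⋖x@((_ , x⋢z) , _) = y≢z (proj₁ (leaving y⊑z x⋢z yx))
    where
    y≢z : y ≢ z
    y≢z refl = ℕ.<⇒≱ (s≤s (s≤s (s≤s z≤n))) (subst (λ vs → 3 ≤ suc (length vs)) (closed-path T (q , q!)) 3≤)
    y⊑z : y ⊑ z
    y⊑z = stays-below q (λ x∈q → All.lookup x∉q x∈q refl) z⋖x

  inPart? : ∀ t → Decidable (λ v → v ∈ N[ set t ] × (∀ s → s ⊏ t → v ∉ set s))
  inPart? t v = (v ∈? N[ set t ]) ×-dec all? (λ s → (s ⊏? t) →-dec ¬? (v ∈? set s))

  abstract
    part : Fin order → Subset n
    part t = ⟪ inPart? t ⟫

    part⁺ : v ∈ N[ set t ] → (∀ s → s ⊏ t → v ∉ set s) → v ∈ part t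
    part⁺ {t = t} v∈N v∉ = ∈⟪⟫⁺ (inPart? t) (v∈N , v∉)

    part⁻ : v ∈ part t → v ∈ N[ set t ] × (∀ s → s ⊏ t → v ∉ set s)
    part⁻ {t = t} = ∈⟪⟫⁻ (inPart? t)

  -- On a step up, `v` is outside `set t₁`, since membership would make `t₁` comparable with `t₃`,
  -- hence strictly below it. Any smaller member of `s` containing `v` would be comparable with
  -- `t₁`, and nothing lies strictly between. On a step down, `t₃` lies below `s`, and what is below
  -- `s` is below `t₁`.
  next : ∀ {t₁ t₃} → Adjᵀ t₁ s → (q : Walk T s t₃) → ¬ (t₁ ∈ˡ walkVertices T q) →
         v ∈ part t₁ → v ∈ part t₃ → v ∈ part s
  next {s} {v} {t₁} {t₃} (inj₁ ((t₁⊑s , s⋢t₁) , between)) q t₁∉q v∈₁ v∈₃ =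
    part⁺ (N-mono (⊑⇒⊆ t₁⊑s) (proj₁ (part⁻ v∈₁))) smaller
    where
    t₃⋢t₁ : ¬ (t₃ ⊑ t₁)
    t₃⋢t₁ = stays-above q t₁∉q s⋢t₁
    v∉t₁ : v ∉ set t₁
    v∉t₁ v∈t₁ with touching (proj₁ (part⁻ v∈₃)) v∈t₁
    ... | inj₁ t₃⊑t₁ = t₃⋢t₁ t₃⊑t₁
    ... | inj₂ t₁⊑t₃ = proj₂ (part⁻ v∈₃) t₁ (t₁⊑t₃ , t₃⋢t₁) v∈t₁
    smaller : ∀ r → r ⊏ s → v ∉ set r
    smaller r (r⊑s , s⋢r) v∈r with touching (proj₁ (part⁻ v∈₁)) v∈r | r ⊑? t₁
    ... | inj₁ t₁⊑r | no  r⋢t₁ = [ r⋢t₁ , s⋢r ]′ (between r t₁⊑r r⊑s)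
    ... | _         | yes r⊑t₁ = v∉t₁ (⊑⇒⊆ r⊑t₁ v∈r)
    ... | inj₂ r⊑t₁ | no  r⋢t₁ = r⋢t₁ r⊑t₁
  next {s} {v} {t₁} {t₃} (inj₂ s⋖t₁@((s⊑t₁ , t₁⋢s) , _)) q t₁∉q v∈₁ v∈₃ =
    part⁺ (N-mono (⊑⇒⊆ t₃⊑s) (proj₁ (part⁻ v∈₃)))
      (λ r (r⊑s , s⋢r) → proj₂ (part⁻ v∈₁) r (⊑-trans r⊑s s⊑t₁ , λ t₁⊑r → s⋢r (⊑-trans s⊑t₁ t₁⊑r)))
    where
    t₃⊑s : t₃ ⊑ s
    t₃⊑s = stays-below q t₁∉q s⋖t₁

  along : ∀ {t₁ t₃} (p : Path T t₁ t₃) → v ∈ part t₁ → v ∈ part t₃ → ∀ {t} → t ∈ˡ vertices T p → v ∈ part t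
  along (ε , _)           v∈₁ v∈₃ (here refl) = v∈₁
  along (_ ◅ _ , _)       v∈₁ v∈₃ (here refl) = v∈₁
  along (e ◅ q , t₁∉q ∷ q!) v∈₁ v∈₃ (there t∈q) =
    along (q , q!) (next e q (λ t₁∈q → All.lookup t₁∉q t₁∈q refl) v∈₁ v∈₃) v∈₃ t∈q

  decomposition : TreeDecomposition G
  decomposition = record
    { order        = order
    ; T            = T
    ; isTree       = 0<order top , paths , acyclic
    ; part         = part
    ; coversVertex = λ v →
        let t , v∈t , min = minimal-node (v ∈?_) (top , ∈top) in
        t , part⁺ (⊆N v∈t) (λ s s⊏t v∈s → min s v∈s s⊏t)
    ; coversEdge   = λ x y xy →
        -- A minimal member containing either end has both ends in its closed neighbourhood, and no
        -- smaller member contains either of them.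
        let t , x∈⊎y∈ , min = minimal-node (λ U → (x ∈? U) ⊎-dec (y ∈? U)) (top , inj₁ ∈top)
            xy∈N = [ (λ x∈t → ⊆N x∈t , adj⇒N x∈t xy) , (λ y∈t → adj⇒N y∈t (Adj-sym xy) , ⊆N y∈t) ]′ x∈⊎y∈
        in t , part⁺ (proj₁ xy∈N) (λ s s⊏t x∈s → min s (inj₁ x∈s) s⊏t)
             , part⁺ (proj₂ xy∈N) (λ s s⊏t y∈s → min s (inj₂ y∈s) s⊏t)
    ; onPath       = λ t₁ t₂ t₃ p t₂∈p v∈ →
        let v∈₁ , v∈₃ = x∈p∩q⁻ (part t₁) (part t₃) v∈ in along p v∈₁ v∈₃ t₂∈p
    }
    where
    open Graph G using () renaming (sym to Adj-sym)
    0<order : ∀ {m} → Fin m → 0 < m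
    0<order zero    = s≤s z≤n
    0<order (suc _) = s≤s z≤n

  part∩part⊆∂ : s ⋖ t → part s ∩ part t ⊆ ∂ (set s)
  part∩part⊆∂ {s} {t} (s⊏t , _) v∈ =
    let v∈s , v∈t = x∈p∩q⁻ (part s) (part t) v∈ in
    N∖⇒∂ (proj₁ (part⁻ v∈s)) (proj₂ (part⁻ v∈t) s s⊏t)

  adhesion : ∀ {k} → (∀ t → ∣ ∂ (set t) ∣ < k) → AdhesionBelow decomposition k
  adhesion small s t (inj₁ s⋖t) = ℕ.≤-<-trans (p⊆q⇒∣p∣≤∣q∣ (part∩part⊆∂ s⋖t)) (small s)
  adhesion small s t (inj₂ t⋖s) = ℕ.≤-<-trans
    (p⊆q⇒∣p∣≤∣q∣ (⊆-trans (⊆-reflexive (∩-comm (part s) (part t))) (part∩part⊆∂ t⋖s))) (small t)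

  -- The action of automorphisms on the tree.

  module Canonicity (invariant : ∀ α U → IsAutomorphism G α → Node U → Node (image α U)) where

    act : ∀ α → IsAutomorphism G α → Fin order → Fin order
    act α aut t = proj₁ (node-index (invariant α (set t) aut (set-node t)))

    set-act : ∀ α aut t → set (act α aut t) ≡ image α (set t)
    set-act α aut t = proj₂ (node-index (invariant α (set t) aut (set-node t)))

    act-⊑ : ∀ α aut → s ⊑ t → act α aut s ⊑ act α aut t
    act-⊑ {s} {t} α aut (incl s⊆t) =
      incl (subst₂ _⊆_ (sym (set-act α aut s)) (sym (set-act α aut t)) (Image.image-mono α s⊆t))

    flip-aut : ∀ α → IsAutomorphism G α → IsAutomorphism G (flip α)
    flip-aut = flip-automorphism {G = G}

    act-inverse : ∀ α aut aut⁻¹ t → act α aut (act (flip α) aut⁻¹ t) ≡ t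
    act-inverse α aut aut⁻¹ t = set-injective (trans (set-act α aut _)
      (trans (cong (image α) (set-act (flip α) aut⁻¹ t)) (Image.image-flip α (set t))))

    act-⊑⁻ : ∀ α aut → act α aut s ⊑ act α aut t → s ⊑ t
    act-⊑⁻ α aut αs⊑αt =
      subst₂ _⊑_ (act-inverse (flip α) (flip-aut α aut) aut _) (act-inverse (flip α) (flip-aut α aut) aut _)
        (act-⊑ (flip α) (flip-aut α aut) αs⊑αt)

    act-⊑-inverse : ∀ α aut → s ⊑ act α aut t → act (flip α) (flip-aut α aut) s ⊑ t
    act-⊑-inverse α aut s⊑αt = act-⊑⁻ α aut (subst (_⊑ _) (sym (act-inverse α aut _ _)) s⊑αt)

    act-⊒-inverse : ∀ α aut → act α aut s ⊑ t → s ⊑ act (flip α) (flip-aut α aut) t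
    act-⊒-inverse α aut αs⊑t = act-⊑⁻ α aut (subst (_ ⊑_) (sym (act-inverse α aut _ _)) αs⊑t)

    act-⊏-inverse : ∀ α aut → s ⊏ act α aut t → act (flip α) (flip-aut α aut) s ⊏ t
    act-⊏-inverse α aut (s⊑αt , αt⋢s) =
      act-⊑-inverse α aut s⊑αt ,
      λ t⊑α⁻¹s → αt⋢s (subst (_ ⊑_) (act-inverse α aut _ _) (act-⊑ α aut t⊑α⁻¹s))

    act-⋖ : ∀ α aut → s ⋖ t → act α aut s ⋖ act α aut t
    act-⋖ {s} {t} α aut ((s⊑t , t⋢s) , between) =
      (act-⊑ α aut s⊑t , λ αt⊑αs → t⋢s (act-⊑⁻ α aut αt⊑αs)) ,
      λ r αs⊑r r⊑αt → case between (act (flip α) (flip-aut α aut) r)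
                             (act-⊒-inverse α aut αs⊑r) (act-⊑-inverse α aut r⊑αt) of λ where
        (inj₁ α⁻¹r⊑s) → inj₁ (subst (_⊑ _) (act-inverse α aut _ r) (act-⊑ α aut α⁻¹r⊑s))
        (inj₂ t⊑α⁻¹r) → inj₂ (subst (_ ⊑_) (act-inverse α aut _ r) (act-⊑ α aut t⊑α⁻¹r))

    act-adj : ∀ α aut → Adjᵀ s t → Adjᵀ (act α aut s) (act α aut t)
    act-adj α aut = [ inj₁ ∘ act-⋖ α aut , inj₂ ∘ act-⋖ α aut ]′

    act-part⁺ : ∀ α aut → v ∈ part t → α ⟨$⟩ʳ v ∈ part (act α aut t)
    act-part⁺ {v} {t} α aut v∈ = part⁺
      (subst (λ U → _ ∈ N[ U ]) (sym (set-act α aut t))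
        (image-N⁺ (subst (_∈ N[ set t ]) (sym (inverseˡ α)) (proj₁ (part⁻ v∈)))))
      (λ s s⊏αt αv∈s → proj₂ (part⁻ v∈) (act (flip α) (flip-aut α aut) s) (act-⊏-inverse α aut s⊏αt)
        (subst (v ∈_) (sym (set-act (flip α) (flip-aut α aut) s)) (Image.image⁺ˡ (flip α) αv∈s)))
      where open ImageBoundary {G = G} α aut

    canonical : Canonical decomposition
    canonical α aut = φ , automorphism , image-part
      where
      open Image α
      aut⁻¹ = flip-aut α aut

      φ : Permutation′ order
      φ = permutation (act α aut) (act (flip α) aut⁻¹)
                      (act-inverse α aut aut⁻¹) (act-inverse (flip α) aut⁻¹ aut)

      automorphism : IsAutomorphism T φ
      automorphism s t = mk⇔ (act-adj α aut)
        (λ αs~αt → subst₂ Adjᵀ (act-inverse (flip α) aut⁻¹ aut s) (act-inverse (flip α) aut⁻¹ aut t)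
                     (act-adj (flip α) aut⁻¹ αs~αt))

      image-part : ∀ t → image α (part t) ≡ part (act α aut t)
      image-part t = ⊆-antisym
        (λ v∈ → subst (_∈ part (act α aut t)) (inverseʳ α) (act-part⁺ α aut (image⁻ v∈)))
        (λ v∈ → image⁺ˡ (subst (λ s → _ ∈ part s) (act-inverse (flip α) aut⁻¹ aut t)
                  (act-part⁺ (flip α) aut⁻¹ v∈)))

-- Automorphism invariance of blocks and components.

module _ (α : Permutation′ n) where
  open Image α

  image-flip-⊆ : ∀ {U W} → U ⊆ image (flip α) W → image α U ⊆ W
  image-flip-⊆ {W = W} U⊆ v∈ = subst (_∈ W) (inverseʳ α) (Image.image⁻ (flip α) (U⊆ (image⁻ v∈)))

  ⊆-image-flip : ∀ {U W} → image α U ⊆ W → U ⊆ image (flip α) W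
  ⊆-image-flip ⊆W v∈U = Image.image⁺ˡ (flip α) (⊆W (image⁺ v∈U))

  ∣image∣ : ∀ U → ∣ image α U ∣ ≡ ∣ U ∣
  ∣image∣ U = ℕ.≤-antisym
    (∣∣-injection (α ⟨$⟩ˡ_)
      (λ eq → trans (sym (inverseʳ α)) (trans (cong (α ⟨$⟩ʳ_) eq) (inverseʳ α)))
      (image α U) U (λ _ → image⁻ {U}))
    (∣∣-injection (α ⟨$⟩ʳ_)
      (λ eq → trans (sym (inverseˡ α)) (trans (cong (α ⟨$⟩ˡ_) eq) (inverseˡ α)))
      U (image α U) (λ _ → image⁺ {U}))

module BlockImages (G : Graph n) where
  open Boundary G
  open Components G

  private
    variable
      X C : Subset n
      k : ℕ

  ∣∂image∣ : ∀ α → IsAutomorphism G α → ∀ U → ∣ ∂ (image α U) ∣ ≡ ∣ ∂ U ∣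
  ∣∂image∣ α aut U = trans (cong ∣_∣ (ImageBoundary.image-∂ {G = G} α aut U)) (∣image∣ α (∂ U))

  unsplit-image : ∀ α → IsAutomorphism G α → Unsplit k X → Unsplit k (image α X)
  unsplit-image {X = X} α aut uns U ∂U<k (x , x∈) =
    let x∈X , x∈U = x∈p∩q⁻ (image α X) U x∈ in
    image-flip-⊆ α λ v∈X → Image.image⁺ˡ (flip α) {N[ U ]} (ImageBoundary.image-N⁻ {G = G} (flip α) aut⁻¹ {U}
      (uns (image (flip α) U) (subst (_< _) (sym (∣∂image∣ (flip α) aut⁻¹ U)) ∂U<k)
        (α ⟨$⟩ˡ x , x∈p∩q⁺ (Image.image⁻ α x∈X , Image.image⁺ (flip α) x∈U)) v∈X))
    where
    aut⁻¹ = flip-automorphism {G = G} α aut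

  block-image : ∀ α → IsAutomorphism G α → Block k X → Block k (image α X)
  block-image {k} {X} α aut ((size , uns) , max) =
    (subst (k ≤_) (sym (∣image∣ α X)) size , unsplit-image α aut uns) ,
    λ Y k≤Y unsY X⊆Y → ⊆-image-flip (flip α)
      (max (image (flip α) Y) (subst (k ≤_) (sym (∣image∣ (flip α) Y)) k≤Y)
        (unsplit-image (flip α) (flip-automorphism {G = G} α aut) unsY) (⊆-image-flip α X⊆Y))

  component-image : ∀ α → IsAutomorphism G α → Component X C → Component (image α X) (image α C)
  component-image {X} {C} α aut ((c , c∈C) , (C∩X=∅ , ∂C⊆X) , conn) =
    (α ⟨$⟩ʳ c , image⁺ c∈C) ,
    ((λ x x∈C x∈X → C∩X=∅ _ (image⁻ x∈C) (image⁻ x∈X)) ,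
     ⊆-trans (⊆-reflexive (ImageBoundary.image-∂ {G = G} α aut C)) (image-mono ∂C⊆X)) ,
    λ W W⊆C (w , w∈W) ∂W⊆X → image-flip-⊆ α
      (conn (image (flip α) W) (image-flip-⊆ (flip α) W⊆C) (_ , Image.image⁺ (flip α) w∈W)
        (⊆-trans (⊆-reflexive (ImageBoundary.image-∂ {G = G} (flip α) (flip-automorphism {G = G} α aut) W))
                 (image-flip-⊆ (flip α) ∂W⊆X)))
    where open Image α

-- Parts and k-blocks

module BlockDecomposition (G : Graph n) {j : ℕ} (connected : Connected G j) (edges : EdgeCondition j G) where
  open Boundary G
  open Components G
  open Nestedness G connected edges
  open BlockImages G

  private
    variable
      U X : Subset n

  node-image : ∀ α U → IsAutomorphism G α → Node U → Node (image α U)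
  node-image α U aut (inj₁ ⊤⊆U) = inj₁ (λ _ → Image.image⁺ˡ α (⊤⊆U ∈⊤))
  node-image α U aut (inj₂ (((∂U≤j , (u , u∈U) , o , o∈opp) , X , block , comp) , small)) =
    inj₂ (((subst (_≤ j) (sym (∣∂image∣ α aut U)) ∂U≤j , (_ , image⁺ u∈U) ,
            _ , subst (_ ∈_) (sym (image-opp U)) (image⁺ o∈opp)) ,
           image α X , block-image α aut block ,
           [ inj₁ ∘ component-image α aut
           , (λ comp → inj₂ (subst (Component (image α X)) (sym (image-opp U)) (component-image α aut comp)))
           ]′ comp) ,
          subst₂ _≤_ (sym (∣image∣ α U)) (sym (trans (cong ∣_∣ (image-opp U)) (∣image∣ α (opp U)))) small)
    where
    open Image α
    open ImageBoundary {G = G} α aut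

  family : LaminarFamily G
  family = record
    { Node     = Node
    ; node?    = node?
    ; ⊤-node   = inj₁ id
    ; nonempty = node-nonempty
    ; laminar  = laminar
    }

  open LaminarTree family public
  open Canonicity node-image using (canonical) public

  adhesion-small : AdhesionBelow decomposition (suc j)
  adhesion-small = adhesion (λ t → s≤s (node-∂ (set-node t)))

  -- Choose a minimal member that meets `X` and has `X` in its closed neighbourhood. By
  -- unsplittability every member meeting `X` has the second property as well, so `X` avoids all
  -- smaller members.
  block-in-part : Block (suc j) X → ∃[ t ] X ⊆ part t
  block-in-part {X} ((size , uns) , _) =
    let x , x∈X , _ = ∣∣<⇒∃ {p = ⊥} (subst (_< ∣ X ∣) (sym (∣⊥∣≡0 n)) (ℕ.≤-trans (s≤s z≤n) size))
        t , (X⊆N , _) , min = minimal-node (λ U → (X ⊆? N[ U ]) ×-dec nonempty? (X ∩ U))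
                                (top , (λ _ → ⊆N ∈top) , x , x∈p∩q⁺ (x∈X , ∈top))
    in t , λ {v} v∈X → part⁺ (X⊆N v∈X) λ s s⊏t v∈s →
         let meets = v , x∈p∩q⁺ (v∈X , v∈s) in
         min s (uns (set s) (s≤s (node-∂ (set-node s))) meets , meets) s⊏t

  part∩node : ∀ {t c v} → v ∈ part t → v ∈ set c → t ⊑ c
  part∩node {t} {c} v∈t v∈c with t ⊑? c
  ... | yes t⊑c = t⊑c
  ... | no  t⋢c with touching (proj₁ (part⁻ v∈t)) v∈c
  ...   | inj₁ t⊑c = t⊑c
  ...   | inj₂ c⊑t = contradiction v∈c (proj₂ (part⁻ v∈t) c (c⊑t , t⋢c))

  -- A member that meets the part of `t` lies above `t`, so its closed neighbourhood contains that
  -- of `t`.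
  part∩node⇒⊆N : ∀ {t v w} → Node U → v ∈ part t → v ∈ U → w ∈ part t → w ∈ N[ U ]
  part∩node⇒⊆N {U} node v∈t v∈U w∈t with node-index node
  ... | c , refl = N-mono (_⊑_.⊑⇒⊆ (part∩node {c = c} v∈t v∈U)) (proj₁ (part⁻ w∈t))

  -- Suppose the part meets a component `C` outside `X`. If `C` is a member of the family, then `X`
  -- lies in `N[ C ]`, hence in `∂ C`, which is too small. Otherwise `opp C` is a member; it meets
  -- `X`, so the part lies in `N[ opp C ]` and misses `C`.
  part-of-block : ∀ {t} → Block (suc j) X → X ⊆ part t → part t ⊆ X
  part-of-block {X} {t} block@((size , _) , _) X⊆t {v} v∈t with v ∈? X
  ... | yes v∈X = v∈X
  ... | no  v∉X with component-of X v v∉X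
  ...   | C , v∈C , comp@(_ , (C∩X=∅ , _) , _) with tight-component block comp | ∣ C ∣ ℕ.≤? ∣ opp C ∣
  ...     | tC@(∂C≤j , _) | yes C≤ = contradiction
        (ℕ.≤-trans size (ℕ.≤-trans (p⊆q⇒∣p∣≤∣q∣ X⊆∂C) ∂C≤j)) ℕ.1+n≰n
    where
    X⊆∂C : X ⊆ ∂ C
    X⊆∂C x∈X = N∖⇒∂ (part∩node⇒⊆N (inj₂ ((tC , X , block , inj₁ comp) , C≤)) v∈t v∈C (X⊆t x∈X))
                     (λ x∈C → C∩X=∅ _ x∈C x∈X)
  ...     | tC@(∂C≤j , _) | no  C≰ =
    let x , x∈X , x∈opp = opp-nonempty connected size C∩X=∅ ∂C≤j
    in contradiction (part∩node⇒⊆N node (X⊆t x∈X) x∈opp v∈t) (opp⁻ (⊆opp² v∈C))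
    where
    node : Node (opp C)
    node = inj₂ ((tight-opp tC , X , block ,
                  inj₂ (subst (Component X) (⊆-antisym ⊆opp² (opp²⊆ tC)) comp)) ,
                 ℕ.≤-trans (ℕ.<⇒≤ (ℕ.≰⇒> C≰)) (p⊆q⇒∣p∣≤∣q∣ {p = C} {opp (opp C)} (⊆opp² {C})))

  part≡block : ∀ {t} → IsBlock G (suc j) X → X ⊆ part t → part t ≡ X
  part≡block isBlock X⊆t = ⊆-antisym (part-of-block (isBlock⇒block isBlock) X⊆t) X⊆t

  blocks-are-parts : BlockPartsAreBlocks decomposition (suc j)
  blocks-are-parts t B isBlock B⊆t = subst (IsBlock G (suc j)) (sym (part≡block isBlock B⊆t)) isBlock

  blocks-in-different-parts : BlocksInDifferentParts decomposition (suc j)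
  blocks-in-different-parts =
    (λ B isBlock → block-in-part (isBlock⇒block isBlock)) ,
    (λ B B′ isB isB′ B≢B′ t t′ B⊆t B′⊆t′ eq →
      B≢B′ (trans (sym (part≡block isB B⊆t)) (trans eq (part≡block isB′ B′⊆t′))))

theorem3p4 :
  ∀ (k : ℕ) → 1 ≤ k → ∀ {n : ℕ} (G : Graph n) →
  Connected G (k ∸ 1) →
  (∀ x y → Graph.Adj G x y →
    (k ∸ 3 ≤ ∣ commonNeighbours G x y ∣)
    ⊎ IndependentPathsOffEdge G ((3 * (k ∸ 2)) / 2) x y
    ⊎ (∃[ B ] (IsBlock G k B × x ∈ B × y ∈ B))) →
  Σ[ D ∈ TreeDecomposition G ]
    (AdhesionBelow D k × Canonical D × BlockPartsAreBlocks D k × BlocksInDifferentParts D k)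
theorem3p4 (suc j) (s≤s z≤n) G connected edges =
  decomposition , adhesion-small , canonical , blocks-are-parts , blocks-in-different-parts
  where
  open BlockDecomposition G connected edges
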